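{- Let $G_1$ be an $r_1$-regular graph with $n_1$ vertices and $m_1$ edges and let $G_2$ be an arbitrary graph with $n_2$ vertices. Then the Laplacian characteristic polynomial of the central vertex corona $G_1\odot G_2$ is (as an identity of rational functions in $x$) $$\begin{aligned}f(L(G_1\odot G_2),x)=\;&(x-2)^{m_1-n_1}\Big[x^3-x^2(n_2+r_1+3)+x(r_1+2n_2+2)\Big]\prod_{j=2}^{n_2}\big(x-1-\mu_j(G_2)\big)^{n_1}\\&\times\prod_{i=2}^{n_1}\Big[x^3-x^2\big(n_1+n_2+3+\lambda_i(G_1)\big)+x\big(2n_2+3n_1+2\lambda_i(G_1)+2-r_1\big)-2n_1+r_1-\lambda_i(G_1)\Big].\end{aligned}$$
   Context: All graphs are finite, simple and connected. For a graph $G$ on $n$ vertices, $A(G)$ is its adjacency matrix with eigenvalues $\lambda_1(G)\ge\dots\ge\lambda_n(G)$; $D(G)$ is the diagonal matrix of vertex degrees; $L(G)=D(G)-A(G)$ is the Laplacian matrix with eigenvalues $0=\mu_1(G)<\mu_2(G)\le\dots\le\mu_n(G)$. For an $n\times n$ matrix $M$, $f(M,x)=\det(xI_n-M)$. The central graph $C(G)$ of $G$ is obtained from $G$ by subdividing each edge of $G$ exactly once and joining all pairs of distinct vertices of $G$ that are nonadjacent in $G$. The central vertex corona $G_1\odot G_2$ is obtained by taking one copy of $C(G_1)$ and $|V(G_1)|$ copies of $G_2$, and joining the vertex $v_i$ of $G_1$ (viewed in $C(G_1)$) to every vertex in the $i$-th copy of $G_2$, for each $i$. -}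

module Defs where

open import Level using (_⊔_) renaming (suc to lsuc)
open import Algebra.Bundles using (CommutativeRing)
open import Algebra.Bundles.Raw using (RawRing)
import Algebra.Definitions.RawSemiring as RawSemiringDefinitions
open import Data.Bool.Base using (if_then_else_)
open import Data.Empty using (⊥)
open import Data.Fin.Base as Fin using (Fin; zero; suc; punchIn; toℕ)
import Data.Fin.Properties as Fin
open import Data.Integer.Base using (ℤ; +_; -[1+_])
open import Data.List.Base as List using (List; []; _∷_; length; filter; allFin; cartesianProduct)
open import Data.Nat.Base as ℕ using (ℕ; zero; suc)
import Data.Nat.Properties as ℕ
open import Data.Nat.Induction using (<-rec)
open import Data.Product.Base using (∃; _×_; _,_)
open import Data.Sum.Base using (_⊎_; inj₁; inj₂)
open import Data.Sum.Function.Propositional using (_⊎-↔_)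
open import Data.Vec.Functional using (Vector)
open import Function.Base using (_∘_)
open import Function.Bundles using (_↔_; Inverse)
open import Function.Construct.Composition using (_↔-∘_)
open import Relation.Binary.Core using (Rel)
open import Relation.Binary.Definitions using (Symmetric; Irreflexive; Decidable)
open import Relation.Binary.Construct.Closure.ReflexiveTransitive using (Star)
open import Relation.Binary.PropositionalEquality as ≡ using (_≡_; _≢_)
open import Relation.Binary.Structures using (IsDecTotalOrder)
import Relation.Binary.Reasoning.Setoid as SetoidReasoning
open import Relation.Nullary using (¬_; yes; no; does; ¬?; contradiction)
open import Relation.Nullary.Decidable using (_×-dec_; _⊎-dec_)

------------------------------------------------------------------------
-- Graphs

record Graph (V : Set) : Set₁ where
  infix 4 _∼_ _∼?_
  field
    _∼_      : V → V → Set
    _∼?_     : Decidable _∼_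
    ∼-sym    : Symmetric _∼_
    ∼-irrefl : Irreflexive _≡_ _∼_

record Connected {V : Set} (G : Graph V) : Set where
  open Graph G
  field
    inhabitant : V
    walk       : ∀ u v → Star _∼_ u v

relabel : {V W : Set} → V ↔ W → Graph W → Graph V
relabel V↔W G = record
  { _∼_      = λ u v → to u ∼ to v
  ; _∼?_     = λ u v → to u ∼? to v
  ; ∼-sym    = ∼-sym
  ; ∼-irrefl = λ u≡v → ∼-irrefl (≡.cong to u≡v)
  }
  where
  open Graph G
  open Inverse V↔W using (to)

module _ {n : ℕ} (G : Graph (Fin n)) where
  open Graph G

  degree : Fin n → ℕ
  degree v = length (filter (v ∼?_) (allFin n))

  -- Each edge {u , v} is listed once, as the pair (u , v) with u < v.
  edges : List (Fin n × Fin n)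
  edges = filter (λ (u , v) → (u Fin.<? v) ×-dec (u ∼? v))
                 (cartesianProduct (allFin n) (allFin n))

  size : ℕ
  size = length edges

  Incident : Fin n → Fin size → Set
  Incident v e = let (a , b) = List.lookup edges e in v ≡ a ⊎ v ≡ b

  incident? : Decidable Incident
  incident? v e = (v Fin.≟ _) ⊎-dec (v Fin.≟ _)

  -- The vertex inj₂ e is the one that subdivides the edge e.
  central : Graph (Fin n ⊎ Fin size)
  central = record
    { _∼_ = _≈>_ ; _∼?_ = dec ; ∼-sym = λ {x} {y} → symm x y ; ∼-irrefl = λ {x} → irr x }
    where
    _≈>_ : Fin n ⊎ Fin size → Fin n ⊎ Fin size → Set
    inj₁ u ≈> inj₁ v = u ≢ v × ¬ (u ∼ v)
    inj₁ u ≈> inj₂ e = Incident u e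
    inj₂ e ≈> inj₁ v = Incident v e
    inj₂ _ ≈> inj₂ _ = ⊥

    dec : Decidable _≈>_
    dec (inj₁ u) (inj₁ v) = ¬? (u Fin.≟ v) ×-dec ¬? (u ∼? v)
    dec (inj₁ u) (inj₂ e) = incident? u e
    dec (inj₂ e) (inj₁ v) = incident? v e
    dec (inj₂ _) (inj₂ _) = no λ ()

    symm : ∀ x y → x ≈> y → y ≈> x
    symm (inj₁ u) (inj₁ v) (u≢v , u≁v) = u≢v ∘ ≡.sym , u≁v ∘ ∼-sym
    symm (inj₁ u) (inj₂ e) p = p
    symm (inj₂ e) (inj₁ v) p = p

    irr : ∀ x {y} → x ≡ y → ¬ (x ≈> y)
    irr (inj₁ u) ≡.refl (u≢u , _) = u≢u ≡.refl
    irr (inj₂ e) ≡.refl ()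

Regular : ℕ → {n : ℕ} → Graph (Fin n) → Set
Regular r G = ∀ v → degree G v ≡ r

module _ {n₁ n₂ : ℕ} (G₁ : Graph (Fin n₁)) (G₂ : Graph (Fin n₂)) where
  private
    module C = Graph (central G₁)
    module G = Graph G₂

  -- The vertex inj₂ (i , u) is the vertex u of the i-th copy of G₂.
  CoronaVertex : Set
  CoronaVertex = (Fin n₁ ⊎ Fin (size G₁)) ⊎ (Fin n₁ × Fin n₂)

  centralVertexCorona : Graph CoronaVertex
  centralVertexCorona = record
    { _∼_ = _≈>_ ; _∼?_ = dec ; ∼-sym = λ {x} {y} → symm x y ; ∼-irrefl = λ {x} → irr x }
    where
    _≈>_ : CoronaVertex → CoronaVertex → Set
    inj₁ a        ≈> inj₁ b        = a C.∼ b
    inj₁ (inj₁ i) ≈> inj₂ (j , _)  = i ≡ j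
    inj₁ (inj₂ _) ≈> inj₂ _        = ⊥
    inj₂ (j , _)  ≈> inj₁ (inj₁ i) = i ≡ j
    inj₂ _        ≈> inj₁ (inj₂ _) = ⊥
    inj₂ (i , u)  ≈> inj₂ (j , v)  = i ≡ j × u G.∼ v

    dec : Decidable _≈>_
    dec (inj₁ a)        (inj₁ b)        = a C.∼? b
    dec (inj₁ (inj₁ i)) (inj₂ (j , _))  = i Fin.≟ j
    dec (inj₁ (inj₂ _)) (inj₂ _)        = no λ ()
    dec (inj₂ (j , _))  (inj₁ (inj₁ i)) = i Fin.≟ j
    dec (inj₂ _)        (inj₁ (inj₂ _)) = no λ ()
    dec (inj₂ (i , u))  (inj₂ (j , v))  = (i Fin.≟ j) ×-dec (u G.∼? v)

    symm : ∀ x y → x ≈> y → y ≈> x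
    symm (inj₁ a)        (inj₁ b)        p         = C.∼-sym p
    symm (inj₁ (inj₁ _)) (inj₂ _)        p         = p
    symm (inj₂ _)        (inj₁ (inj₁ _)) p         = p
    symm (inj₂ _)        (inj₂ _)        (i≡j , p) = ≡.sym i≡j , G.∼-sym p

    irr : ∀ x {y} → x ≡ y → ¬ (x ≈> y)
    irr (inj₁ a) ≡.refl p       = C.∼-irrefl ≡.refl p
    irr (inj₂ _) ≡.refl (_ , p) = G.∼-irrefl ≡.refl p

  infixl 7 _⊙_
  _⊙_ : Graph (Fin ((n₁ ℕ.+ size G₁) ℕ.+ n₁ ℕ.* n₂))
  _⊙_ = relabel ((Fin.+↔⊎ ⊎-↔ Fin.*↔×) ↔-∘ Fin.+↔⊎) centralVertexCorona

------------------------------------------------------------------------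
-- Determinants

module Determinant {c ℓ} (R : RawRing c ℓ) where
  open RawRing R
  open RawSemiringDefinitions rawSemiring using (sum; _^_)

  Matrix : ℕ → Set c
  Matrix n = Fin n → Fin n → Carrier

  det : ∀ {n} → Matrix n → Carrier
  det {zero}  M = 1#
  det {suc n} M = sum λ j →
    (- 1#) ^ toℕ j * (M zero j * det (λ i k → M (suc i) (punchIn j k)))

------------------------------------------------------------------------
-- Ordered fields

-- Classically the real numbers are an instance; constructively the real
-- algebraic numbers are, and these contain all eigenvalues of graphs.
record OrderedField c ℓ₁ ℓ₂ : Set (lsuc (c ⊔ ℓ₁ ⊔ ℓ₂)) where
  infix 4 _≤_
  field
    commutativeRing : CommutativeRing c ℓ₁
  open CommutativeRing commutativeRing public
  field
    _≤_             : Rel Carrier ℓ₂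
    isDecTotalOrder : IsDecTotalOrder _≈_ _≤_
    0≉1             : 0# ≉ 1#
    inverse         : ∀ x → x ≉ 0# → ∃ λ y → x * y ≈ 1#
    +-monoˡ-≤       : ∀ z {x y} → x ≤ y → x + z ≤ y + z
    *-nonNegative   : ∀ {x y} → 0# ≤ x → 0# ≤ y → 0# ≤ x * y
  open IsDecTotalOrder isDecTotalOrder public
    using (_≟_; _≤?_)
    renaming (antisym to ≤-antisym; trans to ≤-trans; reflexive to ≤-reflexive; total to ≤-total)

------------------------------------------------------------------------
-- Polynomials and rational functions in one indeterminate

module Polynomials {c ℓ₁ ℓ₂} (K : OrderedField c ℓ₁ ℓ₂) where
  private
    module K = OrderedField K
    module KS = RawSemiringDefinitions (RawRing.rawSemiring K.rawRing)
  open K using (_≈_; _≉_; 0#; 1#) renaming (Carrier to F)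
  open SetoidReasoning K.setoid

  -- Lists of coefficients, the constant coefficient first; trailing
  -- zeros are allowed.
  Poly : Set c
  Poly = List F

  coeff : Poly → ℕ → F
  coeff []      _       = 0#
  coeff (a ∷ p) zero    = a
  coeff (a ∷ p) (suc k) = coeff p k

  C : F → Poly
  C a = a ∷ []

  X : Poly
  X = 0# ∷ 1# ∷ []

  scale : F → Poly → Poly
  scale a = List.map (a K.*_)

  add : Poly → Poly → Poly
  add []      q       = q
  add (a ∷ p) []      = a ∷ p
  add (a ∷ p) (b ∷ q) = a K.+ b ∷ add p q

  mul : Poly → Poly → Poly
  mul []      q = []
  mul (a ∷ p) q = add (scale a q) (0# ∷ mul p q)

  polyRawRing : RawRing c ℓ₁
  polyRawRing = record
    { Carrier = Poly
    ; _≈_     = λ p q → ∀ k → coeff p k ≈ coeff q k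
    ; _+_     = add
    ; _*_     = mul
    ; -_      = List.map (λ a → K.- a)
    ; 0#      = []
    ; 1#      = C 1#
    }

  open RawRing polyRawRing public
    using (_+_; _*_)
    renaming (_≈_ to _≈ₚ_; _≉_ to _≉ₚ_; -_ to -ₚ_; 0# to 0ₚ; 1# to 1ₚ)
  open RawSemiringDefinitions (RawRing.rawSemiring polyRawRing) public
    using (_^_; product)

  infixl 6 _-_
  _-_ : Poly → Poly → Poly
  p - q = p + (-ₚ q)

  nat : ℕ → Poly
  nat k = C (k KS.× 1#)

  -- The product over i = 2, …, n (that is, over all indices but the first).
  product≥2 : ∀ {n} → Vector Poly n → Poly
  product≥2 {zero}  f = 1ₚ
  product≥2 {suc n} f = product (f ∘ suc)

  coeff-add : ∀ p q k → coeff (p + q) k ≈ coeff p k K.+ coeff q k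
  coeff-add []      q       k       = K.sym (K.+-identityˡ _)
  coeff-add (a ∷ p) []      k       = K.sym (K.+-identityʳ _)
  coeff-add (a ∷ p) (b ∷ q) zero    = K.refl
  coeff-add (a ∷ p) (b ∷ q) (suc k) = coeff-add p q k

  coeff-scale : ∀ a q k → coeff (scale a q) k ≈ a K.* coeff q k
  coeff-scale a []      k       = K.sym (K.zeroʳ a)
  coeff-scale a (b ∷ q) zero    = K.refl
  coeff-scale a (b ∷ q) (suc k) = coeff-scale a q k

  coeff-mul : ∀ a p q k →
              coeff ((a ∷ p) * q) k ≈ a K.* coeff q k K.+ coeff (0# ∷ p * q) k
  coeff-mul a p q k =
    K.trans (coeff-add (scale a q) _ k) (K.+-congʳ (coeff-scale a q k))

  mul-low : ∀ p q k → (∀ {j} → j ℕ.< k → coeff q j ≈ 0#) →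
            ∀ {j} → j ℕ.< k → coeff (p * q) j ≈ 0#
  shift-low : ∀ p q k → (∀ {j} → j ℕ.< k → coeff q j ≈ 0#) →
              ∀ {j} → j ℕ.≤ k → coeff (0# ∷ p * q) j ≈ 0#

  mul-low []      q k q≈0 j<k = K.refl
  mul-low (a ∷ p) q k q≈0 {j} j<k = begin
    coeff ((a ∷ p) * q) j                      ≈⟨ coeff-mul a p q j ⟩
    a K.* coeff q j K.+ coeff (0# ∷ p * q) j   ≈⟨ K.+-cong (K.*-congˡ (q≈0 j<k)) (shift-low p q k q≈0 (ℕ.<⇒≤ j<k)) ⟩
    a K.* 0# K.+ 0#                            ≈⟨ K.+-identityʳ _ ⟩
    a K.* 0#                                   ≈⟨ K.zeroʳ a ⟩
    0#                                         ∎

  shift-low p q k q≈0 {zero}  _   = K.refl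
  shift-low p q k q≈0 {suc j} j<k = mul-low p q k q≈0 j<k

  *-cancel-0 : ∀ {a b} → a ≉ 0# → a K.* b ≈ 0# → b ≈ 0#
  *-cancel-0 {a} {b} a≉0 ab≈0 = let (a⁻¹ , aa⁻¹≈1) = K.inverse a a≉0 in begin
    b                  ≈⟨ K.*-identityˡ b ⟨
    1# K.* b           ≈⟨ K.*-congʳ (K.trans (K.*-comm a⁻¹ a) aa⁻¹≈1) ⟨
    a⁻¹ K.* a K.* b    ≈⟨ K.*-assoc a⁻¹ a b ⟩
    a⁻¹ K.* (a K.* b)  ≈⟨ K.*-congˡ ab≈0 ⟩
    a⁻¹ K.* 0#         ≈⟨ K.zeroʳ a⁻¹ ⟩
    0#                 ∎

  integral : ∀ p q → q ≉ₚ 0ₚ → p * q ≈ₚ 0ₚ → p ≈ₚ 0ₚ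
  integral []      q q≉0 pq≈0 k = K.refl
  integral (a ∷ p) q q≉0 pq≈0 with a K.≟ 0#
  ... | no a≉0 = contradiction q≈0 q≉0
    where
    q≈0 : q ≈ₚ 0ₚ
    q≈0 = <-rec (λ k → coeff q k ≈ 0#) λ k low → *-cancel-0 a≉0 (begin
      a K.* coeff q k                           ≈⟨ K.+-identityʳ _ ⟨
      a K.* coeff q k K.+ 0#                    ≈⟨ K.+-congˡ (shift-low p q k low ℕ.≤-refl) ⟨
      a K.* coeff q k K.+ coeff (0# ∷ p * q) k  ≈⟨ coeff-mul a p q k ⟨
      coeff ((a ∷ p) * q) k                     ≈⟨ pq≈0 k ⟩
      0#                                        ∎)
  ... | yes a≈0 = λ where
      zero    → a≈0
      (suc k) → integral p q q≉0 pq≈0′ k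
    where
    pq≈0′ : p * q ≈ₚ 0ₚ
    pq≈0′ k = begin
      coeff (p * q) k                                ≈⟨ K.+-identityˡ _ ⟨
      0# K.+ coeff (p * q) k                         ≈⟨ K.+-congʳ (K.trans (K.*-congʳ a≈0) (K.zeroˡ _)) ⟨
      a K.* coeff q (suc k) K.+ coeff (p * q) k      ≈⟨ coeff-mul a p q (suc k) ⟨
      coeff ((a ∷ p) * q) (suc k)                    ≈⟨ pq≈0 (suc k) ⟩
      0#                                             ∎

  *-≉0 : ∀ p q → p ≉ₚ 0ₚ → q ≉ₚ 0ₚ → p * q ≉ₚ 0ₚ
  *-≉0 p q p≉0 q≉0 pq≈0 = p≉0 (integral p q q≉0 pq≈0)

  1≉0 : 1ₚ ≉ₚ 0ₚ
  1≉0 1≈0 = K.0≉1 (K.sym (1≈0 0))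

  ^-≉0 : ∀ p → p ≉ₚ 0ₚ → ∀ k → p ^ k ≉ₚ 0ₚ
  ^-≉0 p p≉0 zero    = 1≉0
  ^-≉0 p p≉0 (suc k) = *-≉0 p (p ^ k) p≉0 (^-≉0 p p≉0 k)

  X-nat≉0 : ∀ k → X - nat k ≉ₚ 0ₚ
  X-nat≉0 k X-k≈0 = K.0≉1 (K.sym (X-k≈0 1))

  record RatFun : Set (c ⊔ ℓ₁) where
    constructor _/_⟨_⟩
    field
      num   : Poly
      den   : Poly
      den≉0 : den ≉ₚ 0ₚ
  open RatFun

  infix 4 _≃_
  _≃_ : RatFun → RatFun → Set ℓ₁
  f ≃ g = num f * den g ≈ₚ num g * den f

  infixl 7 _·_
  _·_ : RatFun → RatFun → RatFun
  f · g = (num f * num g) / (den f * den g) ⟨ *-≉0 (den f) (den g) (den≉0 f) (den≉0 g) ⟩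

  fromPoly : Poly → RatFun
  fromPoly p = p / 1ₚ ⟨ 1≉0 ⟩

  zpow : (p : Poly) → p ≉ₚ 0ₚ → ℤ → RatFun
  zpow p p≉0 (+ k)      = fromPoly (p ^ k)
  zpow p p≉0 (-[1+ k ]) = 1ₚ / (p ^ suc k) ⟨ ^-≉0 p p≉0 (suc k) ⟩

------------------------------------------------------------------------
-- Graph matrices and their spectra

module Spectral {c ℓ₁ ℓ₂} (K : OrderedField c ℓ₁ ℓ₂) where
  open Polynomials K public
  private module K = OrderedField K
  open K using (_≤_; 0#; 1#) renaming (Carrier to F)
  open Determinant K.rawRing using (Matrix)
  open Determinant polyRawRing using (det)
  open RawSemiringDefinitions (RawRing.rawSemiring K.rawRing) using () renaming (_×_ to _×K_)

  adjacency : ∀ {n} → Graph (Fin n) → Matrix n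
  adjacency G i j = if does (i ∼? j) then 1# else 0#
    where open Graph G

  degreeMatrix : ∀ {n} → Graph (Fin n) → Matrix n
  degreeMatrix G i j = if does (i Fin.≟ j) then degree G i ×K 1# else 0#

  laplacian : ∀ {n} → Graph (Fin n) → Matrix n
  laplacian G i j = degreeMatrix G i j K.- adjacency G i j

  charpoly : ∀ {n} → Matrix n → Poly
  charpoly M = det λ i j → (if does (i Fin.≟ j) then X else 0ₚ) - C (M i j)

  -- The entries of the vector are the eigenvalues of M, repeated according
  -- to multiplicity.
  Eigenvalues : ∀ {n} → Matrix n → Vector F n → Set ℓ₁
  Eigenvalues M α = charpoly M ≈ₚ product λ i → X - C (α i)

  Ascending Descending : ∀ {n} → Vector F n → Set ℓ₂
  Ascending  α = ∀ i j → i Fin.≤ j → α i ≤ α j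
  Descending α = ∀ i j → i Fin.≤ j → α j ≤ α i

{-# OPTIONS --safe #-}
module Submission where

-- Evaluate both sides at a point x of the field.  Polynomials that agree
-- wherever some fixed nonzero polynomial does not vanish are equal, because
-- the field is infinite (≈ₚ-generic), so x may be assumed to avoid finitely
-- many bad values.  Put y = x - 1 and d = x - 2, both nonzero.
--
-- In the blocks given by the vertices of G₁, the subdivision vertices and the
-- copies of G₂, the matrix x I - L of the corona is
--
--     (x - n₁ - n₂) I + J - A    R      I ⊗ 1ᵀ
--     Rᵀ                         d I    0
--     I ⊗ 1                      0      I ⊗ E
--
-- with A the adjacency matrix and R the incidence matrix of G₁, J the all-ones
-- matrix and E = y I - L(G₂).  Two Schur complements (det-Schur) dispose of the
-- lower blocks.  The columns of E sum to y, so the first one only needs the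
-- scalar 1 / y (det-copies); the second one uses R Rᵀ = A + r₁ I (incidence-gram,
-- det-midpoints).  What remains is
--
--     det E ^ n₁ · d ^ m₁ · det (α I - β A + J),
--     α = x - n₁ - n₂ - n₂ / y - r₁ / d,    β = 1 + 1 / d.
--
-- Here det E is the product of the y - μⱼ, and det (α I - β A) is the product
-- of the α - β λᵢ (det-homogeneous).  All columns of α I - β A sum to
-- s = α - β r₁, and adding J to a matrix with column sums s multiplies its
-- determinant by (s + n₁) / s (det-+ones).  Since λ₁ = r₁, this replaces the
-- factor α - β λ₁ = s by s + n₁.  Since μ₁ = 0, the factor y - μ₁ is y.
-- Multiplying each of the n₁ remaining factors by y d clears the denominators
-- and gives the cubics of the claim.
--
-- That λ₁ = r₁ and μ₁ = 0 has to be derived from the order on the eigenvalues: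
-- r₁ is a root of the characteristic polynomial of A because the columns of
-- r₁ I - A sum to 0, and no x > r₁ is one, because x I - A has nonpositive
-- entries off the diagonal and positive row sums, which makes it nonsingular
-- (dominant⇒det≉0, greatestEigenvalue).  For L(G₂) the same is applied to
-- - L(G₂).
--
-- The theory of determinants needed here is developed from the expansion along
-- the first row: alternation in the first two rows, and from it
-- multiplicativity (det-·ₘ).

open import Defs
open import Algebra.Bundles using (CommutativeRing; RawRing)
import Algebra.Definitions.RawSemiring as RawSemiringDefinitions
import Algebra.Properties.Semiring.Mult.TCOptimised as SemiringMult
import Algebra.Properties.Semiring.Sum as SemiringSum
import Algebra.Solver.Ring as RingSolver
open import Algebra.Solver.Ring.AlmostCommutativeRing using (fromCommutativeRing; _-Raw-AlmostCommutative⟶_)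
open import Data.Bool.Base using (true; false; if_then_else_)
open import Data.Fin.Base as Fin using (Fin; zero; suc; toℕ; punchIn; pinch; _↑ˡ_; _↑ʳ_; splitAt; remQuot)
import Data.Fin.Properties as Fin
open import Data.Integer.Base as ℤ using (ℤ; +_; -[1+_])
import Data.Integer.Properties as ℤ
open import Data.List.Base as Lists using (List; length; lookup; filter; allFin; tabulate; cartesianProduct)
open import Data.List.Membership.Propositional.Properties using (∈-lookup)
import Data.List.Relation.Unary.All as All
import Data.List.Relation.Unary.All.Properties as All
open import Data.Maybe.Base using (Maybe; just; nothing)
open import Data.Nat.Base as ℕ using (ℕ; zero; suc)
import Data.Nat.Properties as ℕ
open import Data.Product.Base as Product using (_×_; _,_; ∃; proj₁; proj₂)
import Data.Product.Properties as Product
open import Data.Sign.Base as Sign using (Sign)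
open import Data.Sum.Base as Sum using (_⊎_; inj₁; inj₂)
open import Data.Sum.Function.Propositional using (_⊎-↔_)
import Data.Sum.Properties as Sum
open import Data.Vec.Functional as Vector using (Vector; tail; removeAt)
open import Function.Base using (_∘_; id)
open import Function.Bundles using (Inverse; _↔_)
open import Function.Construct.Composition using (_↔-∘_)
open import Relation.Binary.Definitions using (DecidableEquality; tri<; tri≈; tri>)
open import Relation.Binary.PropositionalEquality as ≡ using (_≡_; _≢_)
import Relation.Binary.Reasoning.Setoid as SetoidReasoning
open import Relation.Nullary using (¬_; Dec; yes; no; does; contradiction; ¬?)
open import Relation.Nullary.Decidable using (_×-dec_; _⊎-dec_)

------------------------------------------------------------------------
-- The ring solver with integer coefficients

module IntegerCoefficients {c ℓ} (R : CommutativeRing c ℓ) where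
  open CommutativeRing R
  open import Algebra.Properties.Ring ring
  open SemiringMult semiring renaming (_×_ to _×#_)
  open SetoidReasoning setoid

  -- The canonical homomorphism from the integers.
  ⟦_⟧ℤ : ℤ → Carrier
  ⟦ + n ⟧ℤ      = n ×# 1#
  ⟦ -[1+ n ] ⟧ℤ = - (suc n ×# 1#)

  -- A sign acts as multiplication by 1 or - 1.
  signed : Sign → Carrier → Carrier
  signed Sign.+ x = x
  signed Sign.- x = - x

  signed-cong : ∀ s {x y} → x ≈ y → signed s x ≈ signed s y
  signed-cong Sign.+ x≈y = x≈y
  signed-cong Sign.- x≈y = -‿cong x≈y

  signed-* : ∀ s t x y → signed s x * signed t y ≈ signed (s Sign.* t) (x * y)
  signed-* Sign.+ Sign.+ x y = refl
  signed-* Sign.+ Sign.- x y = sym (-‿distribʳ-* x y)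
  signed-* Sign.- Sign.+ x y = sym (-‿distribˡ-* x y)
  signed-* Sign.- Sign.- x y = begin
    - x * - y      ≈⟨ -‿distribˡ-* x (- y) ⟨
    - (x * - y)    ≈⟨ -‿cong (-‿distribʳ-* x y) ⟨
    - (- (x * y))  ≈⟨ -‿involutive (x * y) ⟩
    x * y          ∎

  ⟦◃⟧ : ∀ s n → ⟦ s ℤ.◃ n ⟧ℤ ≈ signed s (n ×# 1#)
  ⟦◃⟧ Sign.+ zero    = refl
  ⟦◃⟧ Sign.- zero    = sym -0#≈0#
  ⟦◃⟧ Sign.+ (suc n) = refl
  ⟦◃⟧ Sign.- (suc n) = refl

  ⟦⟧-signAbs : ∀ i → ⟦ i ⟧ℤ ≈ signed (ℤ.sign i) (ℤ.∣ i ∣ ×# 1#)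
  ⟦⟧-signAbs (+ n)      = refl
  ⟦⟧-signAbs (-[1+ n ]) = refl

  ⟦*⟧ : ∀ i j → ⟦ i ℤ.* j ⟧ℤ ≈ ⟦ i ⟧ℤ * ⟦ j ⟧ℤ
  ⟦*⟧ i j = begin
    ⟦ i ℤ.* j ⟧ℤ
      ≈⟨ ⟦◃⟧ (ℤ.sign i Sign.* ℤ.sign j) (ℤ.∣ i ∣ ℕ.* ℤ.∣ j ∣) ⟩
    signed (ℤ.sign i Sign.* ℤ.sign j) ((ℤ.∣ i ∣ ℕ.* ℤ.∣ j ∣) ×# 1#)
      ≈⟨ signed-cong (ℤ.sign i Sign.* ℤ.sign j) (×1-homo-* ℤ.∣ i ∣ ℤ.∣ j ∣) ⟩
    signed (ℤ.sign i Sign.* ℤ.sign j) ((ℤ.∣ i ∣ ×# 1#) * (ℤ.∣ j ∣ ×# 1#))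
      ≈⟨ signed-* (ℤ.sign i) (ℤ.sign j) _ _ ⟨
    signed (ℤ.sign i) (ℤ.∣ i ∣ ×# 1#) * signed (ℤ.sign j) (ℤ.∣ j ∣ ×# 1#)
      ≈⟨ *-cong (⟦⟧-signAbs i) (⟦⟧-signAbs j) ⟨
    ⟦ i ⟧ℤ * ⟦ j ⟧ℤ ∎

  ⟦⊖⟧ : ∀ m n → ⟦ m ℤ.⊖ n ⟧ℤ ≈ m ×# 1# - n ×# 1#
  ⟦⊖⟧ zero    zero    = sym (-‿inverseʳ 0#)
  ⟦⊖⟧ zero    (suc n) = sym (+-identityˡ _)
  ⟦⊖⟧ (suc m) zero    = begin
    suc m ×# 1#          ≈⟨ +-identityʳ _ ⟨
    suc m ×# 1# + 0#     ≈⟨ +-congˡ -0#≈0# ⟨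
    suc m ×# 1# - 0#     ∎
  ⟦⊖⟧ (suc m) (suc n) = begin
    ⟦ suc m ℤ.⊖ suc n ⟧ℤ                    ≡⟨ ≡.cong ⟦_⟧ℤ (ℤ.[1+m]⊖[1+n]≡m⊖n m n) ⟩
    ⟦ m ℤ.⊖ n ⟧ℤ                            ≈⟨ ⟦⊖⟧ m n ⟩
    m ×# 1# - n ×# 1#                         ≈⟨ +-congʳ (xyx⁻¹≈y 1# (m ×# 1#)) ⟨
    1# + m ×# 1# - 1# - n ×# 1#               ≈⟨ +-assoc _ _ _ ⟩
    1# + m ×# 1# + (- 1# - n ×# 1#)           ≈⟨ +-congˡ (-‿+-comm 1# (n ×# 1#)) ⟩
    1# + m ×# 1# - (1# + n ×# 1#)             ≈⟨ +-cong (1+× m 1#) (-‿cong (1+× n 1#)) ⟨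
    suc m ×# 1# - suc n ×# 1#                 ∎

  ⟦+⟧ : ∀ i j → ⟦ i ℤ.+ j ⟧ℤ ≈ ⟦ i ⟧ℤ + ⟦ j ⟧ℤ
  ⟦+⟧ (+ m)      (+ n)      = ×-homo-+ 1# m n
  ⟦+⟧ (+ m)      (-[1+ n ]) = ⟦⊖⟧ m (suc n)
  ⟦+⟧ (-[1+ m ]) (+ n)      = trans (⟦⊖⟧ n (suc m)) (+-comm _ _)
  ⟦+⟧ (-[1+ m ]) (-[1+ n ]) = begin
    - (suc (suc (m ℕ.+ n)) ×# 1#)      ≡⟨ ≡.cong (λ k → - (suc k ×# 1#)) (ℕ.+-suc m n) ⟨
    - ((suc m ℕ.+ suc n) ×# 1#)        ≈⟨ -‿cong (×-homo-+ 1# (suc m) (suc n)) ⟩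
    - (suc m ×# 1# + suc n ×# 1#)       ≈⟨ -‿+-comm _ _ ⟨
    - (suc m ×# 1#) - suc n ×# 1#       ∎

  ⟦-⟧ : ∀ i → ⟦ ℤ.- i ⟧ℤ ≈ - ⟦ i ⟧ℤ
  ⟦-⟧ (+ zero)   = sym -0#≈0#
  ⟦-⟧ (+ suc n)  = refl
  ⟦-⟧ (-[1+ n ]) = sym (-‿involutive _)

  morphism : ℤ.+-*-rawRing -Raw-AlmostCommutative⟶ fromCommutativeRing R
  morphism = record
    { ⟦_⟧    = ⟦_⟧ℤ
    ; +-homo = ⟦+⟧
    ; *-homo = ⟦*⟧
    ; -‿homo = ⟦-⟧
    ; 0-homo = refl
    ; 1-homo = refl
    }

  _coeff≟_ : ∀ i j → Maybe (⟦ i ⟧ℤ ≈ ⟦ j ⟧ℤ)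
  i coeff≟ j with i ℤ.≟ j
  ... | yes i≡j = just (reflexive (≡.cong ⟦_⟧ℤ i≡j))
  ... | no  _   = nothing

  open RingSolver ℤ.+-*-rawRing (fromCommutativeRing R) morphism _coeff≟_ public
    using (solve; _:=_; con; _:+_; _:*_; _:-_; :-_)

------------------------------------------------------------------------
-- Sums and determinants over a commutative ring

module Determinants {c ℓ} (R : CommutativeRing c ℓ) where
  open CommutativeRing R hiding (zero)
  open Vector using (_∷_)
  open Determinant rawRing public
  open import Algebra.Properties.Semiring.Exp semiring using (_^_)
  open SemiringSum semiring public
    using (sum; sum-cong-≋; sum-remove; ∑-distrib-+; *-distribˡ-sum; *-distribʳ-sum; sum-replicate; sum-replicate-zero)
  open import Algebra.Properties.Ring ring
  open IntegerCoefficients R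
  open SetoidReasoning setoid

  sum-zero : ∀ {n} (f : Vector Carrier n) → (∀ i → f i ≈ 0#) → sum f ≈ 0#
  sum-zero {n} f f≈0 = trans (sum-cong-≋ f≈0) (sum-replicate-zero n)

  sum-++ : ∀ a {b} (f : Vector Carrier (a ℕ.+ b)) →
           sum f ≈ sum (λ i → f (i ↑ˡ b)) + sum (λ j → f (a ↑ʳ j))
  sum-++ zero    f = sym (+-identityˡ _)
  sum-++ (suc a) f = trans (+-congˡ (sum-++ a (tail f))) (sym (+-assoc _ _ _))

  sum-splitAt : ∀ a {b} (f : Fin a ⊎ Fin b → Carrier) →
                sum (f ∘ splitAt a) ≈ sum (f ∘ inj₁) + sum (f ∘ inj₂)
  sum-splitAt zero    f = sym (+-identityˡ _)
  sum-splitAt (suc a) f =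
    trans (+-congˡ (sum-splitAt a (f ∘ Sum.map₁ suc))) (sym (+-assoc _ _ _))

  sum-remQuot : ∀ a {b} (f : Fin a × Fin b → Carrier) →
                sum (f ∘ remQuot b) ≈ sum (λ i → sum λ j → f (i , j))
  sum-remQuot zero        f = refl
  sum-remQuot (suc a) {b} f = begin
    sum (f ∘ remQuot {suc a} b)
      ≈⟨ sum-++ b (f ∘ remQuot {suc a} b) ⟩
    sum (λ j → f (remQuot {suc a} b (j ↑ˡ (a ℕ.* b)))) + sum (λ p → f (remQuot {suc a} b (b ↑ʳ p)))
      ≈⟨ +-cong (sum-cong-≋ λ j → reflexive (≡.cong f (Fin.remQuot-combine {suc a} zero j)))
                (sum-cong-≋ λ p → reflexive (≡.cong (λ s → f (Product.swap (Sum.[ _ , _ ]′ s))) (Fin.splitAt-↑ʳ b (a ℕ.* b) p))) ⟩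
    sum (λ j → f (zero , j)) + sum (λ p → f (Product.map₁ suc (remQuot {a} b p)))
      ≈⟨ +-congˡ (sum-remQuot a (f ∘ Product.map₁ suc)) ⟩
    sum (λ i → sum λ j → f (i , j)) ∎

  -- The Kronecker delta.
  δ : ∀ {n} → Fin n → Fin n → Carrier
  δ i j = if does (i Fin.≟ j) then 1# else 0#

  δ-refl : ∀ {n} (i : Fin n) → δ i i ≈ 1#
  δ-refl zero    = refl
  δ-refl (suc i) = δ-refl i

  δ-sym : ∀ {n} (i j : Fin n) → δ i j ≈ δ j i
  δ-sym zero    zero    = refl
  δ-sym zero    (suc j) = refl
  δ-sym (suc i) zero    = refl
  δ-sym (suc i) (suc j) = δ-sym i j

  sum-δˡ : ∀ {n} (i : Fin n) (f : Vector Carrier n) → sum (λ k → δ i k * f k) ≈ f i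
  sum-δˡ zero    f = begin
    1# * f zero + sum (λ k → 0# * f (suc k))  ≈⟨ +-cong (*-identityˡ _) (sum-zero (λ k → 0# * f (suc k)) λ k → zeroˡ _) ⟩
    f zero + 0#                               ≈⟨ +-identityʳ _ ⟩
    f zero                                    ∎
  sum-δˡ (suc i) f = begin
    0# * f zero + sum (λ k → δ i k * f (suc k))  ≈⟨ +-cong (zeroˡ _) (sum-δˡ i (tail f)) ⟩
    0# + f (suc i)                               ≈⟨ +-identityˡ _ ⟩
    f (suc i)                                    ∎

  sum-δʳ : ∀ {n} (f : Vector Carrier n) (j : Fin n) → sum (λ k → f k * δ k j) ≈ f j
  sum-δʳ f j = trans (sum-cong-≋ λ k → trans (*-comm _ _) (*-congʳ (δ-sym k j))) (sum-δˡ j f)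

  -- The sign of column j in the expansion along the first row.
  sgn : ∀ {n} → Fin n → Carrier
  sgn j = (- 1#) ^ toℕ j

  -- M without its column j.  Applied to the tail of a square matrix, it deletes
  -- row 0 and column j.
  minor : ∀ {m n} → Fin (suc n) → (Fin m → Fin (suc n) → Carrier) → Fin m → Fin n → Carrier
  minor j M i k = M i (punchIn j k)

  det-cong : ∀ {n} {M N : Matrix n} → (∀ i j → M i j ≈ N i j) → det M ≈ det N
  det-cong {zero}  M≈N = refl
  det-cong {suc n} M≈N = sum-cong-≋ λ j →
    *-congˡ {sgn j} (*-cong (M≈N zero j) (det-cong λ i k → M≈N (suc i) (punchIn j k)))

  det-+₀ : ∀ {n} (a b : Vector Carrier (suc n)) M →
           det ((λ j → a j + b j) ∷ M) ≈ det (a ∷ M) + det (b ∷ M)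
  det-+₀ a b M = begin
    sum (λ j → sgn j * ((a j + b j) * det (minor j M)))
      ≈⟨ sum-cong-≋ (λ j → solve 4 (λ s a b d → s :* ((a :+ b) :* d) := s :* (a :* d) :+ s :* (b :* d))
                                  refl (sgn j) (a j) (b j) (det (minor j M))) ⟩
    sum (λ j → sgn j * (a j * det (minor j M)) + sgn j * (b j * det (minor j M)))
      ≈⟨ ∑-distrib-+ (λ j → sgn j * (a j * det (minor j M))) (λ j → sgn j * (b j * det (minor j M))) ⟩
    det (a ∷ M) + det (b ∷ M) ∎

  det-*₀ : ∀ {n} s (a : Vector Carrier (suc n)) M →
           det ((λ j → s * a j) ∷ M) ≈ s * det (a ∷ M)
  det-*₀ s a M = begin
    sum (λ j → sgn j * ((s * a j) * det (minor j M)))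
      ≈⟨ sum-cong-≋ (λ j → solve 4 (λ t s a d → t :* ((s :* a) :* d) := s :* (t :* (a :* d)))
                                  refl (sgn j) s (a j) (det (minor j M))) ⟩
    sum (λ j → s * (sgn j * (a j * det (minor j M))))
      ≈⟨ *-distribˡ-sum s (λ j → sgn j * (a j * det (minor j M))) ⟨
    s * det (a ∷ M) ∎

  det-zero₀ : ∀ {n} {a : Vector Carrier (suc n)} M → (∀ j → a j ≈ 0#) → det (a ∷ M) ≈ 0#
  det-zero₀ {a = a} M a≈0 = sum-zero (λ j → sgn j * (a j * det (minor j M))) λ j → begin
    sgn j * (a j * det (minor j M))  ≈⟨ *-congˡ (*-congʳ (a≈0 j)) ⟩
    sgn j * (0# * det (minor j M))   ≈⟨ *-congˡ (zeroˡ _) ⟩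
    sgn j * 0#                       ≈⟨ zeroʳ _ ⟩
    0#                               ∎

  det-sum₀ : ∀ {m n} (f : Fin m → Vector Carrier (suc n)) M →
             det ((λ j → sum λ k → f k j) ∷ M) ≈ sum λ k → det (f k ∷ M)
  det-sum₀ {zero}  f M = det-zero₀ M λ j → refl
  det-sum₀ {suc m} f M = trans (det-+₀ (f zero) (λ j → sum λ k → f (suc k) j) M) (+-congˡ (det-sum₀ (tail f) M))

  det-+₁ : ∀ {n} r (a b : Vector Carrier (suc (suc n))) M →
           det (r ∷ (λ j → a j + b j) ∷ M) ≈ det (r ∷ a ∷ M) + det (r ∷ b ∷ M)
  det-+₁ r a b M = begin
    sum (λ j → sgn j * (r j * det (minor j ((λ j → a j + b j) ∷ M))))
      ≈⟨ sum-cong-≋ (λ j → *-congˡ {sgn j} (*-congˡ {r j} (det-+₀ (a ∘ punchIn j) (b ∘ punchIn j) (minor j M)))) ⟩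
    sum (λ j → sgn j * (r j * (det (minor j (a ∷ M)) + det (minor j (b ∷ M)))))
      ≈⟨ sum-cong-≋ (λ j → solve 4 (λ s r a b → s :* (r :* (a :+ b)) := s :* (r :* a) :+ s :* (r :* b))
                                  refl (sgn j) (r j) (det (minor j (a ∷ M))) (det (minor j (b ∷ M)))) ⟩
    sum (λ j → sgn j * (r j * det (minor j (a ∷ M))) + sgn j * (r j * det (minor j (b ∷ M))))
      ≈⟨ ∑-distrib-+ (λ j → sgn j * (r j * det (minor j (a ∷ M)))) (λ j → sgn j * (r j * det (minor j (b ∷ M)))) ⟩
    det (r ∷ a ∷ M) + det (r ∷ b ∷ M) ∎

  -- Deleting first j and then k from what is left deletes the same two elements
  -- as deleting first punchIn j k and then pinch k j.  If these two choices
  -- always cancel, the sum over all choices vanishes.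
  sum-antisymmetric : ∀ {n} (H : Fin (suc n) → Fin n → Carrier) →
                      (∀ j k → H j k + H (punchIn j k) (pinch k j) ≈ 0#) →
                      sum (λ j → sum (H j)) ≈ 0#
  sum-antisymmetric {zero}  H anti = +-identityʳ 0#
  sum-antisymmetric {suc n} H anti = begin
    sum (H zero) + sum (λ j → H (suc j) zero + sum (λ k → H (suc j) (suc k)))
      ≈⟨ +-congˡ (∑-distrib-+ (λ j → H (suc j) zero) (λ j → sum (λ k → H (suc j) (suc k)))) ⟩
    sum (H zero) + (sum (λ j → H (suc j) zero) + sum (λ j → sum (λ k → H (suc j) (suc k))))
      ≈⟨ +-assoc _ _ _ ⟨
    sum (H zero) + sum (λ j → H (suc j) zero) + sum (λ j → sum (λ k → H (suc j) (suc k)))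
      ≈⟨ +-cong (sym (∑-distrib-+ (H zero) (λ j → H (suc j) zero))) 
                (sum-antisymmetric (λ j k → H (suc j) (suc k)) λ j k → anti (suc j) (suc k)) ⟩
    sum (λ j → H zero j + H (suc j) zero) + 0#
      ≈⟨ +-congʳ (sum-zero (λ j → H zero j + H (suc j) zero) (anti zero)) ⟩
    0# + 0#
      ≈⟨ +-identityʳ 0# ⟩
    0# ∎

  punchIn-pinch : ∀ {n} (j : Fin (suc n)) k → punchIn (punchIn j k) (pinch k j) ≡ j
  punchIn-pinch zero    zero    = ≡.refl
  punchIn-pinch zero    (suc k) = ≡.refl
  punchIn-pinch (suc j) zero    = ≡.refl
  punchIn-pinch (suc j) (suc k) = ≡.cong suc (punchIn-pinch j k)

  punchIn-punchIn : ∀ {n} (j : Fin (suc (suc n))) k l →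
                    punchIn (punchIn j k) (punchIn (pinch k j) l) ≡ punchIn j (punchIn k l)
  punchIn-punchIn zero    zero    l       = ≡.refl
  punchIn-punchIn zero    (suc k) l       = ≡.refl
  punchIn-punchIn (suc j) zero    l       = ≡.refl
  punchIn-punchIn (suc j) (suc k) zero    = ≡.refl
  punchIn-punchIn (suc j) (suc k) (suc l) = ≡.cong suc (punchIn-punchIn j k l)

  sgn-punchIn : ∀ {n} (j : Fin (suc n)) k → sgn (punchIn j k) * sgn (pinch k j) ≈ - (sgn j * sgn k)
  sgn-punchIn zero    zero    =
    solve 0 ((:- con (+ 1) :* con (+ 1)) :* con (+ 1) := :- (con (+ 1) :* con (+ 1))) refl
  sgn-punchIn zero    (suc k) =
    solve 1 (λ t → (:- con (+ 1) :* (:- con (+ 1) :* t)) :* con (+ 1) := :- (con (+ 1) :* (:- con (+ 1) :* t)))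
          refl (sgn k)
  sgn-punchIn (suc j) zero    =
    solve 1 (λ s → con (+ 1) :* s := :- ((:- con (+ 1) :* s) :* con (+ 1))) refl (sgn j)
  sgn-punchIn (suc j) (suc k) = begin
    - 1# * sgn (punchIn j k) * (- 1# * sgn (pinch k j))
      ≈⟨ solve 2 (λ p q → (:- con (+ 1) :* p) :* (:- con (+ 1) :* q) := p :* q) refl (sgn (punchIn j k)) (sgn (pinch k j)) ⟩
    sgn (punchIn j k) * sgn (pinch k j)
      ≈⟨ sgn-punchIn j k ⟩
    - (sgn j * sgn k)
      ≈⟨ solve 2 (λ p q → :- (p :* q) := :- ((:- con (+ 1) :* p) :* (:- con (+ 1) :* q))) refl (sgn j) (sgn k) ⟩
    - (- 1# * sgn j * (- 1# * sgn k)) ∎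

  -- Expanding along both equal rows, the terms that choose the columns p and
  -- q in either order cancel.
  det-alternating : ∀ {n} a (M : Fin n → Fin (suc (suc n)) → Carrier) → det (a ∷ a ∷ M) ≈ 0#
  det-alternating a M = begin
    sum (λ j → sgn j * (a j * sum (λ k → sgn k * (a (punchIn j k) * D j k))))
      ≈⟨ sum-cong-≋ (λ j → trans (sym (*-assoc (sgn j) (a j) _)) 
                                 (*-distribˡ-sum (sgn j * a j) (λ k → sgn k * (a (punchIn j k) * D j k)))) ⟩
    sum (λ j → sum (H j))
      ≈⟨ sum-antisymmetric H H-antisymmetric ⟩
    0# ∎
    where
    D : ∀ j k → Carrier
    D j k = det (minor k (minor j M))

    H : ∀ j k → Carrier
    H j k = (sgn j * a j) * (sgn k * (a (punchIn j k) * D j k))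

    H-antisymmetric : ∀ j k → H j k + H (punchIn j k) (pinch k j) ≈ 0#
    H-antisymmetric j k = begin
      H j k + H j′ k′
        ≈⟨ +-congˡ (*-congˡ (*-congˡ (*-cong (reflexive (≡.cong a (punchIn-pinch j k)))
             (det-cong λ i l → reflexive (≡.cong (M i) (punchIn-punchIn j k l)))))) ⟩
      H j k + (sgn j′ * a j′) * (sgn k′ * (a j * D j k))
        ≈⟨ solve 7 (λ s t s′ t′ x y d → (s :* x) :* (t :* (y :* d)) :+ (s′ :* y) :* (t′ :* (x :* d))
                                    := (s :* t :+ s′ :* t′) :* (x :* (y :* d)))
             refl (sgn j) (sgn k) (sgn j′) (sgn k′) (a j) (a j′) (D j k) ⟩
      (sgn j * sgn k + sgn j′ * sgn k′) * (a j * (a j′ * D j k))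
        ≈⟨ *-congʳ (trans (+-congˡ (sgn-punchIn j k)) (-‿inverseʳ _)) ⟩
      0# * (a j * (a j′ * D j k))
        ≈⟨ zeroˡ _ ⟩
      0# ∎
      where
      j′ = punchIn j k
      k′ = pinch k j

  -- Alternation for the sum of the two rows, expanded by multilinearity.
  det-swap : ∀ {n} a b (M : Fin n → Fin (suc (suc n)) → Carrier) →
             det (a ∷ b ∷ M) ≈ - det (b ∷ a ∷ M)
  det-swap a b M = +-inverseˡ-unique _ _ (begin
    det (a ∷ b ∷ M) + det (b ∷ a ∷ M)
      ≈⟨ +-cong (+-identityˡ _) (+-identityʳ _) ⟨
    (0# + det (a ∷ b ∷ M)) + (det (b ∷ a ∷ M) + 0#)
      ≈⟨ +-cong (+-congʳ (det-alternating a M)) (+-congˡ (det-alternating b M)) ⟨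
    (det (a ∷ a ∷ M) + det (a ∷ b ∷ M)) + (det (b ∷ a ∷ M) + det (b ∷ b ∷ M))
      ≈⟨ +-cong (det-+₁ a a b M) (det-+₁ b a b M) ⟨
    det (a ∷ a+b ∷ M) + det (b ∷ a+b ∷ M)
      ≈⟨ det-+₀ a b (a+b ∷ M) ⟨
    det (a+b ∷ a+b ∷ M)
      ≈⟨ det-alternating a+b M ⟩
    0# ∎)
    where a+b = λ j → a j + b j

  -- Adding multiples of row 0 to the other rows.  With row 1 swapped to the
  -- front, row 0 is the first row of every minor, which allows induction.
  det-addRow₀ : ∀ {n} r (N : Fin n → Fin (suc n) → Carrier) (c : Vector Carrier n) →
                det (r ∷ λ i j → N i j + c i * r j) ≈ det (r ∷ N)
  det-addRow₀ {zero}  r N c = refl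
  det-addRow₀ {suc n} r N c = begin
    det (r ∷ b+cr ∷ N+cr)
      ≈⟨ det-swap r b+cr N+cr ⟩
    - det (b+cr ∷ r ∷ N+cr)
      ≈⟨ -‿cong (sum-cong-≋ λ j → *-congˡ {sgn j} (*-congˡ {b+cr j}
           (det-addRow₀ (r ∘ punchIn j) (minor j (tail N)) (tail c)))) ⟩
    - det (b+cr ∷ r ∷ tail N)
      ≈⟨ -‿cong (det-+₀ (N zero) (λ j → c zero * r j) (r ∷ tail N)) ⟩
    - (det (N zero ∷ r ∷ tail N) + det ((λ j → c zero * r j) ∷ r ∷ tail N))
      ≈⟨ -‿cong (+-congˡ (trans (det-*₀ (c zero) r (r ∷ tail N)) (*-congˡ (det-alternating r (tail N))))) ⟩
    - (det (N zero ∷ r ∷ tail N) + c zero * 0#)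
      ≈⟨ -‿cong (trans (+-congˡ (zeroʳ _)) (+-identityʳ _)) ⟩
    - det (N zero ∷ r ∷ tail N)
      ≈⟨ det-swap r (N zero) (tail N) ⟨
    det (r ∷ N) ∎
    where
    b+cr = λ j → N zero j + c zero * r j
    N+cr = λ i j → N (suc i) j + c (suc i) * r j

  -- Moving row k to the front takes k transpositions of adjacent rows.
  det-moveRow : ∀ {n} (M : Matrix (suc n)) k → det (M k ∷ removeAt M k) ≈ sgn k * det M
  det-moveRow         M zero    = sym (*-identityˡ _)
  det-moveRow {suc n} M (suc k) = begin
    det (M (suc k) ∷ M zero ∷ removeAt (tail M) k)
      ≈⟨ det-swap (M (suc k)) (M zero) (removeAt (tail M) k) ⟩
    - det (M zero ∷ M (suc k) ∷ removeAt (tail M) k)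
      ≈⟨ -‿cong (sum-cong-≋ λ j → *-congˡ {sgn j} (*-congˡ {M zero j} (det-moveRow (minor j (tail M)) k))) ⟩
    - sum (λ j → sgn j * (M zero j * (sgn k * det (minor j (tail M)))))
      ≈⟨ -‿cong (sum-cong-≋ λ j → solve 4 (λ s x t d → s :* (x :* (t :* d)) := t :* (s :* (x :* d)))
                                         refl (sgn j) (M zero j) (sgn k) (det (minor j (tail M)))) ⟩
    - sum (λ j → sgn k * (sgn j * (M zero j * det (minor j (tail M)))))
      ≈⟨ -‿cong (*-distribˡ-sum (sgn k) (λ j → sgn j * (M zero j * det (minor j (tail M))))) ⟨
    - (sgn k * det M)
      ≈⟨ solve 2 (λ s d → :- (s :* d) := (:- con (+ 1) :* s) :* d) refl (sgn k) (det M) ⟩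
    sgn (suc k) * det M ∎

  -- The product of matrices of compatible sizes.
  infixl 7 _·ₘ_
  _·ₘ_ : ∀ {m n p} → (Fin m → Fin n → Carrier) → (Fin n → Fin p → Carrier) → Fin m → Fin p → Carrier
  (T ·ₘ M) i j = sum λ k → T i k * M k j

  -- The first row of T ·ₘ M is a combination of the rows of M.  Once row k of
  -- M stands in front, it can be cleared from the other rows of T ·ₘ M, which
  -- leaves the product of minors.
  det-·ₘ : ∀ {n} (T M : Matrix n) → det (T ·ₘ M) ≈ det T * det M
  det-·ₘ {zero}  T M = sym (*-identityˡ 1#)
  det-·ₘ {suc n} T M = begin
    det ((λ j → sum λ k → T zero k * M k j) ∷ (tail T ·ₘ M))
      ≈⟨ det-sum₀ (λ k j → T zero k * M k j) (tail T ·ₘ M) ⟩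
    sum (λ k → det ((λ j → T zero k * M k j) ∷ (tail T ·ₘ M)))
      ≈⟨ sum-cong-≋ (λ k → trans (det-*₀ (T zero k) (M k) (tail T ·ₘ M)) (*-congˡ (cleared k))) ⟩
    sum (λ k → T zero k * (det (minor k (tail T)) * (sgn k * det M)))
      ≈⟨ sum-cong-≋ (λ k → solve 4 (λ t d s e → t :* (d :* (s :* e)) := (s :* (t :* d)) :* e)
                                  refl (T zero k) (det (minor k (tail T))) (sgn k) (det M)) ⟩
    sum (λ k → sgn k * (T zero k * det (minor k (tail T))) * det M)
      ≈⟨ *-distribʳ-sum (det M) (λ k → sgn k * (T zero k * det (minor k (tail T)))) ⟨
    det T * det M ∎
    where
    cleared : ∀ k → det (M k ∷ (tail T ·ₘ M)) ≈ det (minor k (tail T)) * (sgn k * det M)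
    cleared k = begin
      det (M k ∷ (tail T ·ₘ M))
        ≈⟨ det-cong {M = M k ∷ (tail T ·ₘ M)}
                    {N = M k ∷ λ i j → (minor k (tail T) ·ₘ removeAt M k) i j + T (suc i) k * M k j} (λ where
             zero    j → refl
             (suc i) j → trans (sum-remove {i = k} (λ l → T (suc i) l * M l j)) (+-comm _ _)) ⟩
      det (M k ∷ λ i j → (minor k (tail T) ·ₘ removeAt M k) i j + T (suc i) k * M k j)
        ≈⟨ det-addRow₀ (M k) (minor k (tail T) ·ₘ removeAt M k) (λ i → T (suc i) k) ⟩
      det (M k ∷ (minor k (tail T) ·ₘ removeAt M k))
        ≈⟨ sum-cong-≋ (λ j → *-congˡ {sgn j} (*-congˡ {M k j} (det-·ₘ (minor k (tail T)) (minor j (removeAt M k))))) ⟩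
      sum (λ j → sgn j * (M k j * (det (minor k (tail T)) * det (minor j (removeAt M k)))))
        ≈⟨ sum-cong-≋ (λ j → solve 4 (λ s m t d → s :* (m :* (t :* d)) := t :* (s :* (m :* d)))
                                    refl (sgn j) (M k j) (det (minor k (tail T))) (det (minor j (removeAt M k)))) ⟩
      sum (λ j → det (minor k (tail T)) * (sgn j * (M k j * det (minor j (removeAt M k)))))
        ≈⟨ *-distribˡ-sum (det (minor k (tail T))) (λ j → sgn j * (M k j * det (minor j (removeAt M k)))) ⟨
      det (minor k (tail T)) * det (M k ∷ removeAt M k)
        ≈⟨ *-congˡ (det-moveRow M k) ⟩
      det (minor k (tail T)) * (sgn k * det M) ∎

------------------------------------------------------------------------
-- Determinants of matrices of a special form

module SpecialDeterminants {c ℓ} (R : CommutativeRing c ℓ) where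
  open CommutativeRing R hiding (zero)
  open Vector using (_∷_)
  open Determinants R
  open import Algebra.Properties.Semiring.Exp semiring using (_^_)
  open import Algebra.Properties.Ring ring
  open IntegerCoefficients R
  open SetoidReasoning setoid

  det-zeroColumn₀ : ∀ {n} (M : Matrix (suc n)) → (∀ i → M i zero ≈ 0#) → det M ≈ 0#
  det-zeroColumn₀ {n} M M₀≈0 = sum-zero (λ j → sgn j * (M zero j * det (minor j (tail M)))) (zeroTerm M M₀≈0)
    where
    zeroTerm : ∀ {n} (M : Matrix (suc n)) → (∀ i → M i zero ≈ 0#) →
               ∀ j → sgn j * (M zero j * det (minor j (tail M))) ≈ 0#
    zeroTerm         M M₀≈0 zero    = trans (*-congˡ (trans (*-congʳ (M₀≈0 zero)) (zeroˡ _))) (zeroʳ _)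
    zeroTerm {suc n} M M₀≈0 (suc j) =
      trans (*-congˡ (trans (*-congˡ (det-zeroColumn₀ (minor (suc j) (tail M)) (λ i → M₀≈0 (suc i)))) (zeroʳ _)))
            (zeroʳ _)

  det-clearedColumn₀ : ∀ {n} (M : Matrix (suc n)) → (∀ i → M (suc i) zero ≈ 0#) →
                       det M ≈ M zero zero * det (minor zero (tail M))
  det-clearedColumn₀ {n} M M₀≈0 = begin
    sgn {suc n} zero * (M zero zero * det (minor zero (tail M)))
      + sum (λ j → sgn (suc j) * (M zero (suc j) * det (minor (suc j) (tail M))))
      ≈⟨ +-cong (*-identityˡ _)
                (sum-zero (λ j → sgn (suc j) * (M zero (suc j) * det (minor (suc j) (tail M)))) (zeroTerm M M₀≈0)) ⟩
    M zero zero * det (minor zero (tail M)) + 0#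
      ≈⟨ +-identityʳ _ ⟩
    M zero zero * det (minor zero (tail M)) ∎
    where
    zeroTerm : ∀ {n} (M : Matrix (suc n)) → (∀ i → M (suc i) zero ≈ 0#) →
               ∀ j → sgn (suc j) * (M zero (suc j) * det (minor (suc j) (tail M))) ≈ 0#
    zeroTerm {suc n} M M₀≈0 j =
      trans (*-congˡ (trans (*-congˡ (det-zeroColumn₀ (minor (suc j) (tail M)) M₀≈0)) (zeroʳ _))) (zeroʳ _)

  det-scalar : ∀ n d → det {n} (λ i j → d * δ i j) ≈ d ^ n
  det-scalar zero    d = refl
  det-scalar (suc n) d = begin
    det (λ i j → d * δ {suc n} i j)   ≈⟨ det-clearedColumn₀ (λ i j → d * δ {suc n} i j) (λ i → zeroʳ d) ⟩
    (d * 1#) * det (λ i j → d * δ {n} i j)  ≈⟨ *-cong (*-identityʳ d) (det-scalar n d) ⟩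
    d * d ^ n                         ∎

  det-δ : ∀ n → det {n} δ ≈ 1#
  det-δ zero    = refl
  det-δ (suc n) = begin
    det (δ {suc n})     ≈⟨ det-clearedColumn₀ (δ {suc n}) (λ i → refl) ⟩
    1# * det (δ {n})    ≈⟨ *-identityˡ _ ⟩
    det (δ {n})         ≈⟨ det-δ n ⟩
    1#                  ∎

  -- Adding all rows to row 0 turns row 0 into s times the all-ones row.
  det-columnSums : ∀ {n} s (M : Matrix (suc n)) → (∀ j → sum (λ i → M i j) ≈ s) →
                   det M ≈ s * det ((λ _ → 1#) ∷ tail M)
  det-columnSums {n} s M columnSum = begin
    det M
      ≈⟨ *-identityˡ _ ⟨
    1# * det M
      ≈⟨ *-congʳ det-T ⟨
    det T * det M
      ≈⟨ det-·ₘ T M ⟨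
    det (T ·ₘ M)
      ≈⟨ det-cong {M = T ·ₘ M} {N = (λ _ → s * 1#) ∷ tail M} TM ⟩
    det ((λ _ → s * 1#) ∷ tail M)
      ≈⟨ det-*₀ s (λ _ → 1#) (tail M) ⟩
    s * det ((λ _ → 1#) ∷ tail M) ∎
    where
    -- Multiplication by T replaces the first row by the sum of all rows.
    T : Matrix (suc n)
    T = (λ _ → 1#) ∷ (λ i j → δ (suc i) j)

    det-T : det T ≈ 1#
    det-T = trans (det-clearedColumn₀ T (λ i → refl)) (trans (*-identityˡ _) (det-δ n))

    TM : ∀ i j → (T ·ₘ M) i j ≈ ((λ _ → s * 1#) ∷ tail M) i j
    TM zero    j = begin
      sum (λ k → 1# * M k j)  ≈⟨ sum-cong-≋ (λ k → *-identityˡ (M k j)) ⟩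
      sum (λ k → M k j)       ≈⟨ columnSum j ⟩
      s                       ≈⟨ *-identityʳ s ⟨
      s * 1#                  ∎
    TM (suc i) j = sum-δˡ (suc i) (λ k → M k j)

  det-+constant : ∀ {n} e (M : Matrix (suc n)) →
                  det ((λ _ → 1#) ∷ λ i j → M (suc i) j + e) ≈ det ((λ _ → 1#) ∷ tail M)
  det-+constant {n} e M = begin
    det ((λ _ → 1#) ∷ λ i j → M (suc i) j + e)
      ≈⟨ det-cong {M = (λ _ → 1#) ∷ λ i j → M (suc i) j + e} {N = (λ _ → 1#) ∷ λ i j → M (suc i) j + e * 1#}
           (λ { zero j → refl ; (suc i) j → +-congˡ (sym (*-identityʳ e)) }) ⟩
    det ((λ _ → 1#) ∷ λ i j → M (suc i) j + e * 1#)
      ≈⟨ det-addRow₀ (λ _ → 1#) (tail M) (λ _ → e) ⟩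
    det ((λ _ → 1#) ∷ tail M) ∎

  -- A square matrix in four blocks; the rows and columns of the first diagonal
  -- block have indices inj₁, those of the second one inj₂.
  BlockMatrix : ℕ → ℕ → Set c
  BlockMatrix a b = Fin a ⊎ Fin b → Fin a ⊎ Fin b → Carrier

  flatten : ∀ {a b} → BlockMatrix a b → Matrix (a ℕ.+ b)
  flatten {a} B p q = B (splitAt a p) (splitAt a q)

  splitAt-punchIn-↑ˡ : ∀ {a b} (j : Fin (suc a)) (k : Fin (a ℕ.+ b)) →
                       splitAt (suc a) (punchIn (j ↑ˡ b) k) ≡ Sum.map₁ (punchIn j) (splitAt a k)
  splitAt-punchIn-↑ˡ         zero    k       = ≡.refl
  splitAt-punchIn-↑ˡ {suc a} (suc j) zero    = ≡.refl
  splitAt-punchIn-↑ˡ {suc a} (suc j) (suc k)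
    rewrite splitAt-punchIn-↑ˡ j k with splitAt a k
  ... | inj₁ _ = ≡.refl
  ... | inj₂ _ = ≡.refl

  det-blockLower : ∀ {a b} (B : BlockMatrix a b) → (∀ i j → B (inj₁ i) (inj₂ j) ≈ 0#) →
                   det (flatten B) ≈ det (λ i j → B (inj₁ i) (inj₁ j)) * det (λ i j → B (inj₂ i) (inj₂ j))
  det-blockLower {zero}      B B₁₂≈0 = sym (*-identityˡ _)
  det-blockLower {suc a} {b} B B₁₂≈0 = begin
    sum term
      ≈⟨ sum-++ (suc a) term ⟩
    sum (λ j → term (j ↑ˡ b)) + sum (λ k → term (suc a ↑ʳ k))
      ≈⟨ +-cong (sum-cong-≋ termˡ) (sum-zero (λ k → term (suc a ↑ʳ k)) termʳ) ⟩
    sum (λ j → (sgn j * (B₁₁ zero j * det (minor j (tail B₁₁)))) * det B₂₂) + 0#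
      ≈⟨ +-identityʳ _ ⟩
    sum (λ j → (sgn j * (B₁₁ zero j * det (minor j (tail B₁₁)))) * det B₂₂)
      ≈⟨ *-distribʳ-sum (det B₂₂) (λ j → sgn j * (B₁₁ zero j * det (minor j (tail B₁₁)))) ⟨
    det B₁₁ * det B₂₂ ∎
    where
    B₁₁ = λ i j → B (inj₁ i) (inj₁ j)
    B₂₂ = λ i j → B (inj₂ i) (inj₂ j)

    term : Fin (suc a ℕ.+ b) → Carrier
    term q = sgn q * (flatten B zero q * det (minor q (tail (flatten B))))

    termˡ : ∀ j → term (j ↑ˡ b) ≈ (sgn j * (B₁₁ zero j * det (minor j (tail B₁₁)))) * det B₂₂
    termˡ j = begin
      sgn (j ↑ˡ b) * (flatten B zero (j ↑ˡ b) * det (minor (j ↑ˡ b) (tail (flatten B))))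
        ≈⟨ *-cong (reflexive (≡.cong ((- 1#) ^_) (Fin.toℕ-↑ˡ j b)))
             (*-cong (reflexive (≡.cong (B (inj₁ zero)) (Fin.splitAt-↑ˡ (suc a) j b)))
                     (det-cong λ i k → reflexive (≡.cong (B (splitAt (suc a) (suc i))) (splitAt-punchIn-↑ˡ j k)))) ⟩
      sgn j * (B₁₁ zero j * det (flatten B′))
        ≈⟨ *-congˡ (*-congˡ (det-blockLower B′ λ i k → B₁₂≈0 (suc i) k)) ⟩
      sgn j * (B₁₁ zero j * (det (minor j (tail B₁₁)) * det B₂₂))
        ≈⟨ solve 4 (λ s x d e → s :* (x :* (d :* e)) := (s :* (x :* d)) :* e)
                 refl (sgn j) (B₁₁ zero j) (det (minor j (tail B₁₁))) (det B₂₂) ⟩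
      (sgn j * (B₁₁ zero j * det (minor j (tail B₁₁)))) * det B₂₂ ∎
      where
      B′ : BlockMatrix a b
      B′ s t = B (Sum.map₁ suc s) (Sum.map₁ (punchIn j) t)

    termʳ : ∀ k → term (suc a ↑ʳ k) ≈ 0#
    termʳ k = begin
      sgn q * (B (inj₁ zero) (splitAt (suc a) q) * D)
        ≈⟨ *-congˡ (*-congʳ (reflexive (≡.cong (B (inj₁ zero)) (Fin.splitAt-↑ʳ (suc a) b k)))) ⟩
      sgn q * (B (inj₁ zero) (inj₂ k) * D)
        ≈⟨ *-congˡ (*-congʳ (B₁₂≈0 zero k)) ⟩
      sgn q * (0# * D)
        ≈⟨ solve 2 (λ s d → s :* (con (+ 0) :* d) := con (+ 0)) refl (sgn q) D ⟩
      0# ∎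
      where
      q = suc a ↑ʳ k
      D = det (minor q (tail (flatten B)))

  det-unitriangular : ∀ {a b} (B : BlockMatrix a b) →
                      (∀ i j → B (inj₁ i) (inj₁ j) ≈ δ i j) → (∀ i j → B (inj₂ i) (inj₁ j) ≈ 0#) →
                      det (flatten B) ≈ det (λ i j → B (inj₂ i) (inj₂ j))
  det-unitriangular {zero}  B B₁₁≈δ B₂₁≈0 = refl
  det-unitriangular {suc a} B B₁₁≈δ B₂₁≈0 = begin
    det (flatten B)
      ≈⟨ det-clearedColumn₀ (flatten B) cleared ⟩
    B (inj₁ zero) (inj₁ zero) * det (flatten B′)
      ≈⟨ *-cong (B₁₁≈δ zero zero) (det-unitriangular B′ (λ i j → B₁₁≈δ (suc i) (suc j)) (λ i j → B₂₁≈0 i (suc j))) ⟩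
    1# * det (λ i j → B (inj₂ i) (inj₂ j))
      ≈⟨ *-identityˡ _ ⟩
    det (λ i j → B (inj₂ i) (inj₂ j)) ∎
    where
    B′ : BlockMatrix a _
    B′ s t = B (Sum.map₁ suc s) (Sum.map₁ suc t)

    cleared : ∀ p → flatten B (suc p) zero ≈ 0#
    cleared p with splitAt a p
    ... | inj₁ i = B₁₁≈δ (suc i) zero
    ... | inj₂ i = B₂₁≈0 i zero

  -- The Schur complement formula.  If the lower right block is invertible, W is
  -- the upper right block times its inverse.  The block matrix is multiplied from
  -- the left by the unitriangular U with upper right block - W, which clears the
  -- upper right block.
  det-Schur : ∀ {a b} (B : BlockMatrix a b) (W : Fin a → Fin b → Carrier) →
              (∀ i j → sum (λ k → W i k * B (inj₂ k) (inj₂ j)) ≈ B (inj₁ i) (inj₂ j)) →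
              det (flatten B) ≈
                det (λ i j → B (inj₁ i) (inj₁ j) - sum (λ k → W i k * B (inj₂ k) (inj₁ j)))
                * det (λ i j → B (inj₂ i) (inj₂ j))
  det-Schur {a} {b} B W WB₂₂≈B₁₂ = begin
    det (flatten B)
      ≈⟨ *-identityˡ _ ⟨
    1# * det (flatten B)
      ≈⟨ *-congʳ (trans (det-unitriangular U (λ i j → refl) (λ i j → refl)) (det-δ b)) ⟨
    det (flatten U) * det (flatten B)
      ≈⟨ det-·ₘ (flatten U) (flatten B) ⟨
    det (flatten U ·ₘ flatten B)
      ≈⟨ det-cong (λ p q → trans (sum-splitAt a (λ r → U (splitAt a p) r * B r (splitAt a q)))
                                 (UB (splitAt a p) (splitAt a q))) ⟩
    det (flatten B′)
      ≈⟨ det-blockLower B′ (λ i j → refl) ⟩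
    det (λ i j → B (inj₁ i) (inj₁ j) - sum (λ k → W i k * B (inj₂ k) (inj₁ j)))
      * det (λ i j → B (inj₂ i) (inj₂ j)) ∎
    where
    U : BlockMatrix a b
    U (inj₁ i) (inj₁ j) = δ i j
    U (inj₁ i) (inj₂ j) = - W i j
    U (inj₂ i) (inj₁ j) = 0#
    U (inj₂ i) (inj₂ j) = δ i j

    B′ : BlockMatrix a b
    B′ (inj₁ i) (inj₁ j) = B (inj₁ i) (inj₁ j) - sum (λ k → W i k * B (inj₂ k) (inj₁ j))
    B′ (inj₁ i) (inj₂ j) = 0#
    B′ (inj₂ i) t        = B (inj₂ i) t

    sum-neg : ∀ i t → sum (λ k → (- W i k) * B (inj₂ k) t) ≈ - sum (λ k → W i k * B (inj₂ k) t)
    sum-neg i t = begin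
      sum (λ k → (- W i k) * B (inj₂ k) t)
        ≈⟨ sum-cong-≋ (λ k → solve 2 (λ w x → (:- w) :* x := :- con (+ 1) :* (w :* x)) refl (W i k) (B (inj₂ k) t)) ⟩
      sum (λ k → - 1# * (W i k * B (inj₂ k) t))
        ≈⟨ *-distribˡ-sum (- 1#) (λ k → W i k * B (inj₂ k) t) ⟨
      - 1# * sum (λ k → W i k * B (inj₂ k) t)
        ≈⟨ -1*x≈-x _ ⟩
      - sum (λ k → W i k * B (inj₂ k) t) ∎

    UB : ∀ s t → sum (λ k → U s (inj₁ k) * B (inj₁ k) t) + sum (λ k → U s (inj₂ k) * B (inj₂ k) t) ≈ B′ s t
    UB (inj₁ i) (inj₁ j) = +-cong (sum-δˡ i (λ k → B (inj₁ k) (inj₁ j))) (sum-neg i (inj₁ j))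
    UB (inj₁ i) (inj₂ j) = begin
      sum (λ k → δ i k * B (inj₁ k) (inj₂ j)) + sum (λ k → (- W i k) * B (inj₂ k) (inj₂ j))
        ≈⟨ +-cong (sum-δˡ i (λ k → B (inj₁ k) (inj₂ j))) (trans (sum-neg i (inj₂ j)) (-‿cong (WB₂₂≈B₁₂ i j))) ⟩
      B (inj₁ i) (inj₂ j) - B (inj₁ i) (inj₂ j)
        ≈⟨ -‿inverseʳ _ ⟩
      0# ∎
    UB (inj₂ i) t = begin
      sum (λ k → 0# * B (inj₁ k) t) + sum (λ k → δ i k * B (inj₂ k) t)
        ≈⟨ +-cong (sum-zero (λ k → 0# * B (inj₁ k) t) (λ k → zeroˡ _)) (sum-δˡ i (λ k → B (inj₂ k) t)) ⟩
      0# + B (inj₂ i) t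
        ≈⟨ +-identityˡ _ ⟩
      B (inj₂ i) t ∎

  -- The determinant of the Kronecker product of an identity matrix with E.
  det-blockDiagonal : ∀ n {m} (E : Matrix m) (D : Fin n × Fin m → Fin n × Fin m → Carrier) →
                      (∀ i u j v → D (i , u) (j , v) ≈ δ i j * E u v) →
                      det (λ p q → D (remQuot m p) (remQuot m q)) ≈ det E ^ n
  det-blockDiagonal zero        E D D≈ = refl
  det-blockDiagonal (suc n) {m} E D D≈ = begin
    det (λ p q → D (remQuot {suc n} m p) (remQuot {suc n} m q))
      ≈⟨ det-blockLower B (λ u p → trans (D≈ _ _ _ _) (zeroˡ _)) ⟩
    det (λ u v → D (zero , u) (zero , v))
      * det (λ p q → D (Product.map₁ suc (remQuot {n} m p)) (Product.map₁ suc (remQuot {n} m q)))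
      ≈⟨ *-cong (det-cong λ u v → trans (D≈ zero u zero v) (*-identityˡ _))
                (det-blockDiagonal n E (λ x y → D (Product.map₁ suc x) (Product.map₁ suc y))
                                   (λ i u j v → D≈ (suc i) u (suc j) v)) ⟩
    det E * det E ^ n ∎
    where
    remQuot′ : Fin m ⊎ Fin (n ℕ.* m) → Fin (suc n) × Fin m
    remQuot′ s = Product.swap (Sum.[ (_, zero) , Product.map₂ suc ∘ Fin.quotRem {n} m ]′ s)

    B : BlockMatrix m (n ℕ.* m)
    B s t = D (remQuot′ s) (remQuot′ t)

------------------------------------------------------------------------
-- Ordered fields, dominant matrices and extreme eigenvalues

module OrderedFieldProperties {c ℓ₁ ℓ₂} (K : OrderedField c ℓ₁ ℓ₂) where
  open OrderedField K hiding (zero)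
  open import Algebra.Properties.Ring ring
  open import Algebra.Properties.Semiring.Mult semiring using () renaming (_×_ to _×#_)
  open import Algebra.Properties.Semiring.Exp semiring using (_^_)
  open RawSemiringDefinitions (RawRing.rawSemiring rawRing) using (product)
  open IntegerCoefficients commutativeRing
  open Determinants commutativeRing
  open SpecialDeterminants commutativeRing
  open SetoidReasoning setoid

  NonNegative Positive : Carrier → Set _
  NonNegative x = 0# ≤ x
  Positive x    = NonNegative x × x ≉ 0#

  ≤-respʳ : ∀ {x y z} → y ≈ z → x ≤ y → x ≤ z
  ≤-respʳ y≈z x≤y = ≤-trans x≤y (≤-reflexive y≈z)

  nonNegative-+ : ∀ {x y} → NonNegative x → NonNegative y → NonNegative (x + y)
  nonNegative-+ {x} {y} 0≤x 0≤y =
    ≤-trans 0≤y (≤-trans (≤-reflexive (sym (+-identityˡ y))) (+-monoˡ-≤ y 0≤x))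

  nonNegative-sum : ∀ {n} (f : Vector Carrier n) → (∀ i → NonNegative (f i)) → NonNegative (sum f)
  nonNegative-sum {zero}  f 0≤f = ≤-reflexive refl
  nonNegative-sum {suc n} f 0≤f = nonNegative-+ (0≤f zero) (nonNegative-sum (tail f) (0≤f ∘ suc))

  positive-+ : ∀ {x y} → Positive x → NonNegative y → Positive (x + y)
  positive-+ {x} {y} (0≤x , x≉0) 0≤y = nonNegative-+ 0≤x 0≤y , λ x+y≈0 →
    x≉0 (≤-antisym (≤-respʳ x+y≈0 (≤-trans (≤-reflexive (sym (+-identityˡ x)))
                     (≤-respʳ (+-comm y x) (+-monoˡ-≤ x 0≤y)))) 0≤x)

  positive-resp : ∀ {x y} → x ≈ y → Positive x → Positive y
  positive-resp x≈y (0≤x , x≉0) = ≤-respʳ x≈y 0≤x , λ y≈0 → x≉0 (trans x≈y y≈0)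

  ≤⇒nonNegative : ∀ {x y} → x ≤ y → NonNegative (y - x)
  ≤⇒nonNegative {x} x≤y = ≤-trans (≤-reflexive (sym (-‿inverseʳ x))) (+-monoˡ-≤ (- x) x≤y)

  ≤0⇒nonNegative : ∀ {x} → x ≤ 0# → NonNegative (- x)
  ≤0⇒nonNegative x≤0 = ≤-respʳ (+-identityˡ _) (≤⇒nonNegative x≤0)

  nonNegative⇒≤ : ∀ {x y} → NonNegative (y - x) → x ≤ y
  nonNegative⇒≤ {x} {y} 0≤y-x =
    ≤-trans (≤-reflexive (sym (+-identityˡ x)))
            (≤-respʳ (solve 2 (λ x y → (y :- x) :+ x := y) refl x y) (+-monoˡ-≤ x 0≤y-x))

  positive-1 : Positive 1#
  positive-1 with ≤-total 0# 1#
  ... | inj₁ 0≤1 = 0≤1 , (0≉1 ∘ sym)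
  ... | inj₂ 1≤0 = ≤-respʳ (solve 0 ((:- con (+ 1)) :* (:- con (+ 1)) := con (+ 1)) refl)
                     (*-nonNegative (≤0⇒nonNegative 1≤0) (≤0⇒nonNegative 1≤0)) , (0≉1 ∘ sym)

  nonNegative-×1 : ∀ k → NonNegative (k ×# 1#)
  nonNegative-×1 zero    = ≤-reflexive refl
  nonNegative-×1 (suc k) = nonNegative-+ (proj₁ positive-1) (nonNegative-×1 k)

  positive-×1 : ∀ k → Positive (suc k ×# 1#)
  positive-×1 k = positive-+ positive-1 (nonNegative-×1 k)

  inverse-nonNegative : ∀ {x y} → Positive x → x * y ≈ 1# → NonNegative y
  inverse-nonNegative {x} {y} (0≤x , _) xy≈1 with ≤-total 0# y
  ... | inj₁ 0≤y = 0≤y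
  ... | inj₂ y≤0 = contradiction (≤-antisym (proj₁ positive-1) 1≤0) 0≉1
    where
    1≤0 : 1# ≤ 0#
    1≤0 = nonNegative⇒≤ (≤-respʳ
      (trans (sym (-‿distribʳ-* x y)) (trans (-‿cong xy≈1) (sym (+-identityˡ _))))
      (*-nonNegative 0≤x (≤0⇒nonNegative y≤0)))

  *-cancelˡ-0 : ∀ {a b} → a ≉ 0# → a * b ≈ 0# → b ≈ 0#
  *-cancelˡ-0 = Polynomials.*-cancel-0 K

  *-≉0 : ∀ {a b} → a ≉ 0# → b ≉ 0# → a * b ≉ 0#
  *-≉0 a≉0 b≉0 ab≈0 = b≉0 (*-cancelˡ-0 a≉0 ab≈0)

  *-cancelˡ : ∀ {a x y} → a ≉ 0# → a * x ≈ a * y → x ≈ y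
  *-cancelˡ {a} {x} {y} a≉0 ax≈ay = x∙y⁻¹≈ε⇒x≈y x y (*-cancelˡ-0 a≉0 (begin
    a * (x - y)    ≈⟨ x[y-z]≈xy-xz a x y ⟩
    a * x - a * y  ≈⟨ +-congʳ ax≈ay ⟩
    a * y - a * y  ≈⟨ -‿inverseʳ _ ⟩
    0#             ∎))

  -- A matrix with nonpositive entries off the diagonal and positive row sums is
  -- nonsingular.  The entry M₀₀ is positive, and clearing column 0 below it leaves
  -- a matrix S that satisfies both hypotheses again.
  dominant⇒det≉0 : ∀ {n} (M : Matrix n) → (∀ i j → i ≢ j → NonNegative (- M i j)) →
                   (∀ i → Positive (sum (M i))) → det M ≉ 0#
  dominant⇒det≉0 {zero}  M off ρ>0 = 0≉1 ∘ sym
  dominant⇒det≉0 {suc n} M off ρ>0 det≈0 =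
    *-≉0 (proj₂ M₀₀>0) (dominant⇒det≉0 S S-off S-ρ) (trans (sym det-M) det≈0)
    where
    M₀₀ = M zero zero
    ρ   = λ i → sum (M i)

    rest : Fin (suc n) → Carrier
    rest i = sum (λ j → M i (suc j))

    M₀₀>0 : Positive M₀₀
    M₀₀>0 = positive-resp (begin
      ρ zero + sum (λ j → - M zero (suc j))            ≈⟨ +-congˡ (sum-cong-≋ λ j → sym (-1*x≈-x (M zero (suc j)))) ⟩
      ρ zero + sum (λ j → - 1# * M zero (suc j))       ≈⟨ +-congˡ (*-distribˡ-sum (- 1#) (λ j → M zero (suc j))) ⟨
      ρ zero + - 1# * rest zero                        ≈⟨ solve 2 (λ a b → (a :+ b) :+ (:- con (+ 1)) :* b := a) refl M₀₀ (rest zero) ⟩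
      M₀₀                                              ∎)
      (positive-+ (ρ>0 zero) (nonNegative-sum (λ j → - M zero (suc j)) λ j → off zero (suc j) λ ()))

    M₀₀⁻¹ = proj₁ (inverse M₀₀ (proj₂ M₀₀>0))
    M₀₀-inverse = proj₂ (inverse M₀₀ (proj₂ M₀₀>0))

    factor : Vector Carrier n
    factor i = - M (suc i) zero * M₀₀⁻¹

    factor≥0 : ∀ i → NonNegative (factor i)
    factor≥0 i = *-nonNegative (off (suc i) zero λ ()) (inverse-nonNegative M₀₀>0 M₀₀-inverse)

    factor-M₀₀ : ∀ i → factor i * M₀₀ ≈ - M (suc i) zero
    factor-M₀₀ i = begin
      - M (suc i) zero * M₀₀⁻¹ * M₀₀    ≈⟨ solve 3 (λ m y x → m :* y :* x := m :* (x :* y)) refl (- M (suc i) zero) M₀₀⁻¹ M₀₀ ⟩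
      - M (suc i) zero * (M₀₀ * M₀₀⁻¹)  ≈⟨ *-congˡ M₀₀-inverse ⟩
      - M (suc i) zero * 1#             ≈⟨ *-identityʳ _ ⟩
      - M (suc i) zero                  ∎

    cleared : Fin n → Fin (suc n) → Carrier
    cleared i j = M (suc i) j + factor i * M zero j

    S : Matrix n
    S i j = cleared i (suc j)

    det-M : det M ≈ M₀₀ * det S
    det-M = trans (sym (det-addRow₀ (M zero) (tail M) factor))
      (det-clearedColumn₀ (M zero Vector.∷ cleared)
        (λ i → trans (+-congˡ (factor-M₀₀ i)) (-‿inverseʳ _)))

    S-off : ∀ i j → i ≢ j → NonNegative (- S i j)
    S-off i j i≢j = ≤-respʳ
      (solve 3 (λ a f b → (:- a) :+ f :* (:- b) := :- (a :+ f :* b)) refl (M (suc i) (suc j)) (factor i) (M zero (suc j)))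
      (nonNegative-+ (off (suc i) (suc j) (i≢j ∘ Fin.suc-injective))
                     (*-nonNegative (factor≥0 i) (off zero (suc j) λ ())))

    S-ρ : ∀ i → Positive (sum (S i))
    S-ρ i = positive-resp (begin
      ρ (suc i) + factor i * ρ zero
        ≈⟨ solve 5 (λ a b f x y → (a :+ b) :+ f :* (x :+ y) := (b :+ f :* y) :+ (a :+ f :* x)) refl
             (M (suc i) zero) (rest (suc i)) (factor i) M₀₀ (rest zero) ⟩
      (rest (suc i) + factor i * rest zero) + (M (suc i) zero + factor i * M₀₀)
        ≈⟨ +-congˡ (trans (+-congˡ (factor-M₀₀ i)) (-‿inverseʳ _)) ⟩
      (rest (suc i) + factor i * rest zero) + 0#
        ≈⟨ +-identityʳ _ ⟩
      rest (suc i) + factor i * rest zero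
        ≈⟨ +-congˡ (*-distribˡ-sum (factor i) (λ j → M zero (suc j))) ⟩
      rest (suc i) + sum (λ j → factor i * M zero (suc j))
        ≈⟨ ∑-distrib-+ (λ j → M (suc i) (suc j)) (λ j → factor i * M zero (suc j)) ⟨
      sum (S i) ∎)
      (positive-+ (ρ>0 (suc i)) (*-nonNegative (factor≥0 i) (proj₁ (ρ>0 zero))))

  product-cong : ∀ {n} {f g : Vector Carrier n} → (∀ i → f i ≈ g i) → product f ≈ product g
  product-cong {zero}  f≈g = refl
  product-cong {suc n} f≈g = *-cong (f≈g zero) (product-cong (f≈g ∘ suc))

  product-* : ∀ {n} s (f : Vector Carrier n) → product (λ i → s * f i) ≈ s ^ n * product f
  product-* {zero}  s f = sym (*-identityˡ 1#)
  product-* {suc n} s f = trans (*-congˡ (product-* s (tail f)))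
    (solve 4 (λ s x y z → (s :* x) :* (y :* z) := (s :* y) :* (x :* z)) refl s (f zero) (s ^ n) (product (tail f)))

  product-^ : ∀ {n} k (f : Vector Carrier n) → product (λ i → f i ^ k) ≈ product f ^ k
  product-^ {zero}  zero    f = refl
  product-^ {zero}  (suc k) f = trans (product-^ {zero} k f) (sym (*-identityˡ _))
  product-^ {suc n} k       f = trans (*-congˡ (product-^ k (tail f)))
    (sym (^-distrib-* (f zero) (product (tail f)) k))
    where open import Algebra.Properties.CommutativeSemiring.Exp commutativeSemiring using (^-distrib-*)

  product-≈0 : ∀ {n} (f : Vector Carrier n) → product f ≈ 0# → ∃ λ i → f i ≈ 0#
  product-≈0 {zero}  f ∏≈0 = contradiction (sym ∏≈0) 0≉1
  product-≈0 {suc n} f ∏≈0 with f zero ≟ 0#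
  ... | yes f₀≈0 = zero , f₀≈0
  ... | no  f₀≉0 = Product.map suc (λ f≈0 → f≈0) (product-≈0 (tail f) (*-cancelˡ-0 f₀≉0 ∏≈0))

  -- The matrix x I - M.
  shifted : ∀ {n} → Carrier → Matrix n → Matrix n
  shifted x M i j = x * δ i j - M i j

  det-* : ∀ {n} s (M : Matrix n) → det (λ i j → s * M i j) ≈ s ^ n * det M
  det-* {n} s M = begin
    det (λ i j → s * M i j)
      ≈⟨ det-cong (λ i j → trans (sum-cong-≋ λ k → *-assoc s (δ i k) (M k j))
           (trans (sym (*-distribˡ-sum s (λ k → δ i k * M k j))) (*-congˡ (sum-δˡ i (λ k → M k j))))) ⟨
    det ((λ i k → s * δ i k) ·ₘ M)
      ≈⟨ det-·ₘ (λ i k → s * δ i k) M ⟩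
    det {n} (λ i k → s * δ i k) * det M
      ≈⟨ *-congʳ (det-scalar n s) ⟩
    s ^ n * det M ∎

  -- The homogeneous form of a factorization of the characteristic polynomial,
  -- which is evaluated at a / b.
  det-homogeneous : ∀ {n} (M : Matrix n) (α : Vector Carrier n) → (∀ x → det (shifted x M) ≈ product (λ i → x - α i)) →
                    ∀ a b → b ≉ 0# → det (λ i j → a * δ i j - b * M i j) ≈ product (λ i → a - b * α i)
  det-homogeneous {n} M α factored a b b≉0 = begin
    det (λ i j → a * δ i j - b * M i j)
      ≈⟨ det-cong (λ i j → scaled (δ i j) (M i j)) ⟩
    det (λ i j → b * shifted (a * b⁻¹) M i j)
      ≈⟨ det-* b (shifted (a * b⁻¹) M) ⟩
    b ^ n * det (shifted (a * b⁻¹) M)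
      ≈⟨ *-congˡ (factored (a * b⁻¹)) ⟩
    b ^ n * product (λ i → a * b⁻¹ - α i)
      ≈⟨ product-* b (λ i → a * b⁻¹ - α i) ⟨
    product (λ i → b * (a * b⁻¹ - α i))
      ≈⟨ product-cong (λ i → trans (*-congˡ (+-congʳ (sym (*-identityʳ _))))
                                   (trans (sym (scaled 1# (α i))) (+-congʳ (*-identityʳ a)))) ⟩
    product (λ i → a - b * α i) ∎
    where
    b⁻¹ = proj₁ (inverse b b≉0)
    scaled : ∀ d m → a * d - b * m ≈ b * (a * b⁻¹ * d - m)
    scaled d m = sym (begin
      b * (a * b⁻¹ * d - m)
        ≈⟨ solve 5 (λ a b c d m → b :* (a :* c :* d :- m) := (b :* c) :* (a :* d) :- b :* m) refl a b b⁻¹ d m ⟩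
      (b * b⁻¹) * (a * d) - b * m
        ≈⟨ +-congʳ (trans (*-congʳ (proj₂ (inverse b b≉0))) (*-identityˡ _)) ⟩
      a * d - b * m ∎)

  -- The number r is an eigenvalue, because the columns of r I - M sum to 0.  If
  -- the greatest eigenvalue were not r, it would be some x > r, for which x I - M
  -- has positive row sums and hence is nonsingular.
  greatestEigenvalue : ∀ {n} r (M : Matrix (suc n)) (α : Vector Carrier (suc n)) →
                       (∀ i j → M i j ≈ M j i) → (∀ i j → i ≢ j → NonNegative (M i j)) →
                       (∀ i → sum (M i) ≈ r) →
                       (∀ x → det (shifted x M) ≈ product (λ i → x - α i)) →
                       (∀ i → α i ≤ α zero) → α zero ≈ r
  greatestEigenvalue r M α M-sym M≥0 rowSum factored α≤α₀ with α zero ≟ r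
  ... | yes α₀≈r = α₀≈r
  ... | no  α₀≉r = contradiction det≈0 (dominant⇒det≉0 (shifted (α zero) M) off ρ>0)
    where
    rowSum-shifted : ∀ x i → sum (shifted x M i) ≈ x - r
    rowSum-shifted x i = begin
      sum (λ j → x * δ i j - M i j)
        ≈⟨ ∑-distrib-+ (λ j → x * δ i j) (λ j → - M i j) ⟩
      sum (λ j → x * δ i j) + sum (λ j → - M i j)
        ≈⟨ +-cong (trans (sum-cong-≋ λ j → *-comm x (δ i j)) (sum-δˡ i (λ _ → x)))
             (trans (sum-cong-≋ λ j → sym (-1*x≈-x (M i j))) (sym (*-distribˡ-sum (- 1#) (M i)))) ⟩
      x + - 1# * sum (M i)
        ≈⟨ +-congˡ (trans (-1*x≈-x _) (-‿cong (rowSum i))) ⟩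
      x - r ∎

    r-root : product (λ i → r - α i) ≈ 0#
    r-root = begin
      product (λ i → r - α i)
        ≈⟨ factored r ⟨
      det (shifted r M)
        ≈⟨ det-columnSums 0# (shifted r M) (λ j → trans
             (sum-cong-≋ λ i → +-cong (*-congˡ {r} (δ-sym i j)) (-‿cong (M-sym i j)))
             (trans (rowSum-shifted r j) (-‿inverseʳ r))) ⟩
      0# * det ((λ _ → 1#) Vector.∷ tail (shifted r M))
        ≈⟨ zeroˡ _ ⟩
      0# ∎

    r≤α₀ : r ≤ α zero
    r≤α₀ = let (i , r-αᵢ≈0) = product-≈0 (λ i → r - α i) r-root in
      ≤-trans (≤-reflexive (x∙y⁻¹≈ε⇒x≈y r (α i) r-αᵢ≈0)) (α≤α₀ i)

    off : ∀ i j → i ≢ j → NonNegative (- shifted (α zero) M i j)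
    off i j i≢j with i Fin.≟ j
    ... | yes i≡j = contradiction i≡j i≢j
    ... | no  _   = ≤-respʳ (solve 2 (λ x m → m := :- (x :* con (+ 0) :- m)) refl (α zero) (M i j)) (M≥0 i j i≢j)

    ρ>0 : ∀ i → Positive (sum (shifted (α zero) M i))
    ρ>0 i = positive-resp (sym (rowSum-shifted (α zero) i))
      (≤⇒nonNegative r≤α₀ , λ α₀-r≈0 → α₀≉r (x∙y⁻¹≈ε⇒x≈y (α zero) r α₀-r≈0))

    det≈0 : det (shifted (α zero) M) ≈ 0#
    det≈0 = begin
      det (shifted (α zero) M)           ≈⟨ factored (α zero) ⟩
      product (λ i → α zero - α i)       ≈⟨ *-congʳ (-‿inverseʳ (α zero)) ⟩
      0# * product (λ i → α zero - α (suc i))  ≈⟨ zeroˡ _ ⟩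
      0#                                 ∎

  -- The greatest eigenvalue of - M is the opposite of the least one of M.
  leastEigenvalue : ∀ {n} r (M : Matrix (suc n)) (α : Vector Carrier (suc n)) →
                    (∀ i j → M i j ≈ M j i) → (∀ i j → i ≢ j → NonNegative (- M i j)) →
                    (∀ i → sum (M i) ≈ r) →
                    (∀ x → det (shifted x M) ≈ product (λ i → x - α i)) →
                    (∀ i → α zero ≤ α i) → α zero ≈ r
  leastEigenvalue {n} r M α M-sym M≤0 rowSum factored α₀≤α = -‿injective
    (greatestEigenvalue (- r) (λ i j → - M i j) (λ i → - α i)
      (λ i j → -‿cong (M-sym i j)) M≤0
      (λ i → trans (sum-cong-≋ λ j → sym (-1*x≈-x (M i j)))
               (trans (sym (*-distribˡ-sum (- 1#) (M i))) (trans (-1*x≈-x _) (-‿cong (rowSum i)))))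
      factored⁻
      (λ i → nonNegative⇒≤ (≤-respʳ (solve 2 (λ x y → x :- y := :- y :- :- x) refl (α i) (α zero)) (≤⇒nonNegative (α₀≤α i)))))
    where
    factored⁻ : ∀ x → det (shifted x (λ i j → - M i j)) ≈ product (λ i → x - - α i)
    factored⁻ x = begin
      det (shifted x (λ i j → - M i j))
        ≈⟨ det-cong (λ i j → solve 3 (λ x d m → x :* d :- :- m := (:- con (+ 1)) :* ((:- x) :* d :- m)) refl x (δ i j) (M i j)) ⟩
      det (λ i j → - 1# * shifted (- x) M i j)
        ≈⟨ det-* (- 1#) (shifted (- x) M) ⟩
      (- 1#) ^ suc n * det (shifted (- x) M)
        ≈⟨ *-congˡ (factored (- x)) ⟩
      (- 1#) ^ suc n * product (λ i → - x - α i)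
        ≈⟨ product-* (- 1#) (λ i → - x - α i) ⟨
      product (λ i → - 1# * (- x - α i))
        ≈⟨ product-cong (λ i → solve 2 (λ x y → (:- con (+ 1)) :* (:- x :- y) := x :- :- y) refl x (α i)) ⟩
      product (λ i → x - - α i) ∎

------------------------------------------------------------------------
-- Evaluation of polynomials

module Evaluation {c ℓ₁ ℓ₂} (K : OrderedField c ℓ₁ ℓ₂) where
  open OrderedField K hiding (zero)
  open Lists using ([]; _∷_; _++_)
  open import Algebra.Properties.Ring ring
  open import Algebra.Properties.Semiring.Mult semiring using (×-homo-+) renaming (_×_ to _×#_)
  open IntegerCoefficients commutativeRing
  open Determinants commutativeRing
  open OrderedFieldProperties K
  open SetoidReasoning setoid
  open Spectral K using (Poly; coeff; C; X; 0ₚ; 1ₚ; _≈ₚ_; _≉ₚ_; -ₚ_; scale; nat; coeff-add; integral; charpoly; polyRawRing)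
  private
    module P = Spectral K
    module PR = RawSemiringDefinitions (RawRing.rawSemiring polyRawRing)
    module F = RawSemiringDefinitions (RawRing.rawSemiring rawRing)
    module PD = Determinant polyRawRing

  eval : Poly → Carrier → Carrier
  eval []      x = 0#
  eval (a ∷ p) x = a + x * eval p x

  eval-≈0 : ∀ p x → p ≈ₚ 0ₚ → eval p x ≈ 0#
  eval-≈0 []      x p≈0 = refl
  eval-≈0 (a ∷ p) x p≈0 = begin
    a + x * eval p x  ≈⟨ +-cong (p≈0 0) (*-congˡ (eval-≈0 p x (p≈0 ∘ suc))) ⟩
    0# + x * 0#       ≈⟨ trans (+-identityˡ _) (zeroʳ x) ⟩
    0#                ∎

  eval-cong : ∀ p q x → p ≈ₚ q → eval p x ≈ eval q x
  eval-cong []      q       x p≈q = sym (eval-≈0 q x (sym ∘ p≈q))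
  eval-cong (a ∷ p) []      x p≈q = eval-≈0 (a ∷ p) x p≈q
  eval-cong (a ∷ p) (b ∷ q) x p≈q = +-cong (p≈q 0) (*-congˡ (eval-cong p q x (p≈q ∘ suc)))

  module _ (x : Carrier) where

    eval-+ : ∀ p q → eval (p P.+ q) x ≈ eval p x + eval q x
    eval-+ []      q       = sym (+-identityˡ _)
    eval-+ (a ∷ p) []      = sym (+-identityʳ _)
    eval-+ (a ∷ p) (b ∷ q) = begin
      (a + b) + x * eval (p P.+ q) x
        ≈⟨ +-congˡ (*-congˡ (eval-+ p q)) ⟩
      (a + b) + x * (eval p x + eval q x)
        ≈⟨ solve 5 (λ a b x p q → (a :+ b) :+ x :* (p :+ q) := (a :+ x :* p) :+ (b :+ x :* q)) refl a b x (eval p x) (eval q x) ⟩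
      eval (a ∷ p) x + eval (b ∷ q) x ∎

    eval-scale : ∀ a p → eval (scale a p) x ≈ a * eval p x
    eval-scale a []      = sym (zeroʳ a)
    eval-scale a (b ∷ p) = begin
      a * b + x * eval (scale a p) x  ≈⟨ +-congˡ (*-congˡ (eval-scale a p)) ⟩
      a * b + x * (a * eval p x)      ≈⟨ solve 4 (λ a b x p → a :* b :+ x :* (a :* p) := a :* (b :+ x :* p)) refl a b x (eval p x) ⟩
      a * (b + x * eval p x)          ∎

    eval-* : ∀ p q → eval (p P.* q) x ≈ eval p x * eval q x
    eval-* []      q = sym (zeroˡ _)
    eval-* (a ∷ p) q = begin
      eval (scale a q P.+ (0# ∷ p P.* q)) x
        ≈⟨ eval-+ (scale a q) (0# ∷ p P.* q) ⟩
      eval (scale a q) x + (0# + x * eval (p P.* q) x)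
        ≈⟨ +-cong (eval-scale a q) (+-congˡ (*-congˡ (eval-* p q))) ⟩
      a * eval q x + (0# + x * (eval p x * eval q x))
        ≈⟨ solve 4 (λ a x p q → a :* q :+ (con (+ 0) :+ x :* (p :* q)) := (a :+ x :* p) :* q) refl a x (eval p x) (eval q x) ⟩
      eval (a ∷ p) x * eval q x ∎

    eval-neg : ∀ p → eval (-ₚ p) x ≈ - eval p x
    eval-neg []      = sym -0#≈0#
    eval-neg (a ∷ p) = begin
      - a + x * eval (-ₚ p) x  ≈⟨ +-congˡ (*-congˡ (eval-neg p)) ⟩
      - a + x * - eval p x     ≈⟨ solve 3 (λ a x p → :- a :+ x :* :- p := :- (a :+ x :* p)) refl a x (eval p x) ⟩
      - (a + x * eval p x)     ∎

    eval-- : ∀ p q → eval (p P.- q) x ≈ eval p x - eval q x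
    eval-- p q = trans (eval-+ p (-ₚ q)) (+-congˡ (eval-neg q))

    eval-C : ∀ a → eval (C a) x ≈ a
    eval-C a = trans (+-congˡ (zeroʳ x)) (+-identityʳ a)

    eval-X : eval X x ≈ x
    eval-X = solve 1 (λ x → con (+ 0) :+ x :* (con (+ 1) :+ x :* con (+ 0)) := x) refl x

    eval-^ : ∀ p k → eval (p P.^ k) x ≈ eval p x F.^ k
    eval-^ p zero    = eval-C 1#
    eval-^ p (suc k) = trans (eval-* p (p P.^ k)) (*-congˡ (eval-^ p k))

    eval-product : ∀ {n} (f : Vector Poly n) → eval (P.product f) x ≈ F.product (λ i → eval (f i) x)
    eval-product {zero}  f = eval-C 1#
    eval-product {suc n} f = trans (eval-* (f zero) (P.product (tail f))) (*-congˡ (eval-product (tail f)))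

    eval-sum : ∀ {n} (f : Vector Poly n) → eval (PR.sum f) x ≈ sum (λ i → eval (f i) x)
    eval-sum {zero}  f = refl
    eval-sum {suc n} f = trans (eval-+ (f zero) (PR.sum (tail f))) (+-congˡ (eval-sum (tail f)))

    eval-det : ∀ {n} (M : PD.Matrix n) → eval (PD.det M) x ≈ det (λ i j → eval (M i j) x)
    eval-det {zero}  M = eval-C 1#
    eval-det {suc n} M = trans (eval-sum term) (sum-cong-≋ λ j → begin
      eval (term j) x
        ≈⟨ eval-* ((-ₚ 1ₚ) P.^ toℕ j) (M zero j P.* PD.det (minorₚ j)) ⟩
      eval ((-ₚ 1ₚ) P.^ toℕ j) x * eval (M zero j P.* PD.det (minorₚ j)) x
        ≈⟨ *-cong (eval-sgn (toℕ j)) (eval-* (M zero j) (PD.det (minorₚ j))) ⟩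
      sgn j * (eval (M zero j) x * eval (PD.det (minorₚ j)) x)
        ≈⟨ *-congˡ (*-congˡ (eval-det (minorₚ j))) ⟩
      sgn j * (eval (M zero j) x * det (λ i k → eval (minorₚ j i k) x)) ∎)
      where
      minorₚ : Fin (suc n) → PD.Matrix n
      minorₚ j i k = M (suc i) (punchIn j k)

      term : Fin (suc n) → Poly
      term j = (-ₚ 1ₚ) P.^ toℕ j P.* (M zero j P.* PD.det (minorₚ j))

      eval-sgn : ∀ k → eval ((-ₚ 1ₚ) P.^ k) x ≈ (- 1#) F.^ k
      eval-sgn zero    = eval-C 1#
      eval-sgn (suc k) = trans (eval-* (-ₚ 1ₚ) ((-ₚ 1ₚ) P.^ k)) (*-cong (eval-C (- 1#)) (eval-sgn k))

    eval-charpoly : ∀ {n} (M : Matrix n) → eval (charpoly M) x ≈ det (shifted x M)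
    eval-charpoly M = trans (eval-det (λ i j → (if does (i Fin.≟ j) then X else 0ₚ) P.- C (M i j))) (det-cong entry)
      where
      entry : ∀ i j → eval ((if does (i Fin.≟ j) then X else 0ₚ) P.- C (M i j)) x ≈ x * δ i j - M i j
      entry i j with does (i Fin.≟ j)
      ... | true  = trans (eval-- X (C (M i j))) (+-cong (trans eval-X (sym (*-identityʳ x))) (-‿cong (eval-C (M i j))))
      ... | false = trans (eval-- 0ₚ (C (M i j))) (+-cong (sym (zeroʳ x)) (-‿cong (eval-C (M i j))))

    eval-charpoly-eigenvalues : ∀ {n} (M : Matrix n) α → P.Eigenvalues M α →
                                det (shifted x M) ≈ F.product (λ i → x - α i)
    eval-charpoly-eigenvalues M α factored = begin
      det (shifted x M)
        ≈⟨ eval-charpoly M ⟨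
      eval (charpoly M) x
        ≈⟨ eval-cong (charpoly M) (P.product λ i → X P.- C (α i)) x factored ⟩
      eval (P.product λ i → X P.- C (α i)) x
        ≈⟨ eval-product (λ i → X P.- C (α i)) ⟩
      F.product (λ i → eval (X P.- C (α i)) x)
        ≈⟨ product-cong (λ i → trans (eval-- X (C (α i))) (+-cong eval-X (-‿cong (eval-C (α i))))) ⟩
      F.product (λ i → x - α i) ∎

  -- The quotient of the polynomial a ∷ p by X - r; it does not depend on a.
  quotient : Carrier → Poly → Poly
  quotient r []      = []
  quotient r (a ∷ p) = eval (a ∷ p) r ∷ quotient r p

  length-quotient : ∀ r p → length (quotient r p) ≡ length p
  length-quotient r []      = ≡.refl
  length-quotient r (a ∷ p) = ≡.cong suc (length-quotient r p)

  eval-quotient : ∀ r a p x → eval (a ∷ p) x ≈ (x - r) * eval (quotient r p) x + eval (a ∷ p) r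
  eval-quotient r a []      x =
    solve 3 (λ r a x → a :+ x :* con (+ 0) := (x :- r) :* con (+ 0) :+ (a :+ r :* con (+ 0))) refl r a x
  eval-quotient r a (b ∷ p) x = begin
    a + x * eval (b ∷ p) x
      ≈⟨ +-congˡ (*-congˡ (eval-quotient r b p x)) ⟩
    a + x * ((x - r) * eval (quotient r p) x + eval (b ∷ p) r)
      ≈⟨ solve 5 (λ r a x q e → a :+ x :* ((x :- r) :* q :+ e) := (x :- r) :* (e :+ x :* q) :+ (a :+ r :* e))
               refl r a x (eval (quotient r p) x) (eval (b ∷ p) r) ⟩
    (x - r) * (eval (b ∷ p) r + x * eval (quotient r p) x) + (a + r * eval (b ∷ p) r) ∎

  quotient-≈0 : ∀ r p → quotient r p ≈ₚ 0ₚ → p ≈ₚ 0ₚ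
  quotient-≈0 r []      q≈0 = q≈0
  quotient-≈0 r (a ∷ p) q≈0 (suc k) = quotient-≈0 r p (q≈0 ∘ suc) k
  quotient-≈0 r (a ∷ p) q≈0 zero    = begin
    a                 ≈⟨ trans (+-congˡ (zeroʳ r)) (+-identityʳ a) ⟨
    a + r * 0#        ≈⟨ +-congˡ (*-congˡ (eval-≈0 p r (quotient-≈0 r p (q≈0 ∘ suc)))) ⟨
    a + r * eval p r  ≈⟨ q≈0 0 ⟩
    0#                ∎

  -- A polynomial that vanishes at m, m + 1, m + 2, … is zero: its quotient by
  -- X - m has fewer coefficients and vanishes at m + 1, m + 2, …
  vanishing : ∀ n p → length p ≡ n → ∀ m → (∀ k → eval p ((m ℕ.+ k) ×# 1#) ≈ 0#) → p ≈ₚ 0ₚ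
  vanishing n       []      _    m p≈0 k       = refl
  vanishing (suc n) (a ∷ p) ∣p∣≡n m p≈0 = λ where
      zero    → begin
        a                 ≈⟨ trans (+-congˡ (zeroʳ r)) (+-identityʳ a) ⟨
        a + r * 0#        ≈⟨ +-congˡ (*-congˡ (eval-≈0 p r tail≈0)) ⟨
        a + r * eval p r  ≈⟨ r-root ⟩
        0#                ∎
      (suc k) → tail≈0 k
    where
    r = m ×# 1#

    r-root : eval (a ∷ p) r ≈ 0#
    r-root = trans (reflexive (≡.cong (λ k → eval (a ∷ p) (k ×# 1#)) (≡.sym (ℕ.+-identityʳ m)))) (p≈0 0)

    distinct : ∀ k → (suc m ℕ.+ k) ×# 1# - r ≉ 0#
    distinct k e≈0 = proj₂ (positive-×1 k) (begin
      suc k ×# 1#                         ≈⟨ solve 2 (λ d r → d := (r :+ d) :- r) refl (suc k ×# 1#) r ⟩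
      r + suc k ×# 1# - r                 ≈⟨ +-congʳ (×-homo-+ 1# m (suc k)) ⟨
      (m ℕ.+ suc k) ×# 1# - r             ≡⟨ ≡.cong (λ k → k ×# 1# - r) (ℕ.+-suc m k) ⟩
      (suc m ℕ.+ k) ×# 1# - r             ≈⟨ e≈0 ⟩
      0#                                  ∎)

    tail≈0 : p ≈ₚ 0ₚ
    tail≈0 = quotient-≈0 r p (vanishing n (quotient r p)
      (≡.trans (length-quotient r p) (ℕ.suc-injective ∣p∣≡n)) (suc m) λ k →
      let x = (suc m ℕ.+ k) ×# 1# in
      *-cancelˡ-0 (distinct k) (begin
        (x - r) * eval (quotient r p) x                       ≈⟨ +-identityʳ _ ⟨
        (x - r) * eval (quotient r p) x + 0#                  ≈⟨ +-congˡ r-root ⟨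
        (x - r) * eval (quotient r p) x + eval (a ∷ p) r      ≈⟨ eval-quotient r a p x ⟨
        eval (a ∷ p) x                                        ≡⟨ ≡.cong (λ k → eval (a ∷ p) (k ×# 1#)) (ℕ.+-suc m k) ⟨
        eval (a ∷ p) ((m ℕ.+ suc k) ×# 1#)                    ≈⟨ p≈0 (suc k) ⟩
        0#                                                    ∎))

  coeff-neg : ∀ p k → coeff (-ₚ p) k ≈ - coeff p k
  coeff-neg []      k       = sym -0#≈0#
  coeff-neg (a ∷ p) zero    = refl
  coeff-neg (a ∷ p) (suc k) = coeff-neg p k

  -- Polynomials are determined by their values outside the roots of a nonzero
  -- polynomial s, because otherwise (p - q) * s would be a nonzero polynomial
  -- that vanishes everywhere.
  ≈ₚ-generic : ∀ s p q → s ≉ₚ 0ₚ → (∀ x → eval s x ≉ 0# → eval p x ≈ eval q x) → p ≈ₚ q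
  ≈ₚ-generic s p q s≉0 p≈q k = x∙y⁻¹≈ε⇒x≈y _ _ (begin
    coeff p k - coeff q k           ≈⟨ +-congˡ (coeff-neg q k) ⟨
    coeff p k + coeff (-ₚ q) k      ≈⟨ coeff-add p (-ₚ q) k ⟨
    coeff (p P.- q) k               ≈⟨ integral (p P.- q) s s≉0 (vanishing _ ((p P.- q) P.* s) ≡.refl 0 λ k → zeroAt (k ×# 1#)) k ⟩
    0#                              ∎)
    where
    zeroAt : ∀ x → eval ((p P.- q) P.* s) x ≈ 0#
    zeroAt x with eval s x ≟ 0#
    ... | yes s≈0 = trans (eval-* x (p P.- q) s) (trans (*-congˡ s≈0) (zeroʳ _))
    ... | no  s≉0 = trans (eval-* x (p P.- q) s) (trans (*-congʳ (trans (eval-- x p q)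
                      (trans (+-congʳ (p≈q x s≉0)) (-‿inverseʳ _)))) (zeroˡ _))

------------------------------------------------------------------------
-- Iverson brackets, adjacency and incidence

module IversonBrackets {c ℓ} (R : CommutativeRing c ℓ) where
  open CommutativeRing R hiding (zero)
  open Lists using ([]; _∷_; _++_)
  open import Algebra.Properties.Semiring.Mult semiring using () renaming (_×_ to _×#_)
  open import Algebra.Properties.Ring ring
  open Determinants R
  open SetoidReasoning setoid

  -- The Iverson bracket: 1 if the proposition holds and 0 otherwise.
  iverson : ∀ {p} {P : Set p} → Dec P → Carrier
  iverson P? = if does P? then 1# else 0#

  iverson-yes : ∀ {p} {P : Set p} (P? : Dec P) → P → iverson P? ≈ 1#
  iverson-yes (yes _) p = refl
  iverson-yes (no ¬p) p = contradiction p ¬p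

  iverson-no : ∀ {p} {P : Set p} (P? : Dec P) → ¬ P → iverson P? ≈ 0#
  iverson-no (yes p) ¬p = contradiction p ¬p
  iverson-no (no _)  ¬p = refl

  iverson-cong : ∀ {p q} {P : Set p} {Q : Set q} (P? : Dec P) (Q? : Dec Q) →
                 (P → Q) → (Q → P) → iverson P? ≈ iverson Q?
  iverson-cong (yes p) Q? to from = sym (iverson-yes Q? (to p))
  iverson-cong (no ¬p) Q? to from = sym (iverson-no Q? (¬p ∘ from))

  iverson-× : ∀ {p q} {P : Set p} {Q : Set q} (P? : Dec P) (Q? : Dec Q) →
              iverson (P? ×-dec Q?) ≈ iverson P? * iverson Q?
  iverson-× (yes _) Q? = sym (*-identityˡ _)
  iverson-× (no _)  Q? = sym (zeroˡ _)

  iverson-¬ : ∀ {p} {P : Set p} (P? : Dec P) → iverson (¬? P?) ≈ 1# - iverson P?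
  iverson-¬ (yes _) = sym (-‿inverseʳ 1#)
  iverson-¬ (no _)  = sym (trans (+-congˡ -0#≈0#) (+-identityʳ 1#))

  iverson-⊎ : ∀ {p q} {P : Set p} {Q : Set q} (P? : Dec P) (Q? : Dec Q) → ¬ (P × Q) →
              iverson (P? ⊎-dec Q?) ≈ iverson P? + iverson Q?
  iverson-⊎ (yes p) (yes q) ¬pq = contradiction (p , q) ¬pq
  iverson-⊎ (yes _) (no _)  ¬pq = sym (+-identityʳ 1#)
  iverson-⊎ (no _)  Q?      ¬pq = sym (+-identityˡ _)

  -- The sum of g over the entries of a list.
  listSum : ∀ {a} {A : Set a} → (A → Carrier) → List A → Carrier
  listSum g []       = 0#
  listSum g (x ∷ xs) = g x + listSum g xs

  sum-lookup : ∀ {a} {A : Set a} (g : A → Carrier) xs → sum (g ∘ lookup xs) ≈ listSum g xs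
  sum-lookup g []       = refl
  sum-lookup g (x ∷ xs) = +-congˡ (sum-lookup g xs)

  length-listSum : ∀ {a} {A : Set a} (xs : List A) → length xs ×# 1# ≈ listSum (λ _ → 1#) xs
  length-listSum []       = refl
  length-listSum (x ∷ xs) = +-congˡ (length-listSum xs)

  listSum-++ : ∀ {a} {A : Set a} (g : A → Carrier) xs ys → listSum g (xs ++ ys) ≈ listSum g xs + listSum g ys
  listSum-++ g []       ys = sym (+-identityˡ _)
  listSum-++ g (x ∷ xs) ys = trans (+-congˡ (listSum-++ g xs ys)) (sym (+-assoc _ _ _))

  listSum-map : ∀ {a b} {A : Set a} {B : Set b} (g : B → Carrier) (f : A → B) xs →
                listSum g (Lists.map f xs) ≈ listSum (g ∘ f) xs
  listSum-map g f []       = refl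
  listSum-map g f (x ∷ xs) = +-congˡ (listSum-map g f xs)

  listSum-tabulate : ∀ {a} {A : Set a} (g : A → Carrier) {n} (f : Fin n → A) →
                     listSum g (tabulate f) ≈ sum (g ∘ f)
  listSum-tabulate g {zero}  f = refl
  listSum-tabulate g {suc n} f = +-congˡ (listSum-tabulate g (f ∘ suc))

  listSum-filter : ∀ {a p} {A : Set a} {P : A → Set p} (g : A → Carrier) (P? : ∀ x → Dec (P x)) xs →
                   listSum g (filter P? xs) ≈ listSum (λ x → iverson (P? x) * g x) xs
  listSum-filter g P? []       = refl
  listSum-filter g P? (x ∷ xs) with does (P? x)
  ... | true  = +-cong (sym (*-identityˡ _)) (listSum-filter g P? xs)
  ... | false = begin
    listSum g (filter P? xs)                         ≈⟨ listSum-filter g P? xs ⟩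
    listSum (λ x → iverson (P? x) * g x) xs          ≈⟨ +-identityˡ _ ⟨
    0# + listSum (λ x → iverson (P? x) * g x) xs     ≈⟨ +-congʳ (zeroˡ (g x)) ⟨
    0# * g x + listSum (λ x → iverson (P? x) * g x) xs ∎

  listSum-cartesianProduct : ∀ {a b} {A : Set a} {B : Set b} (g : A × B → Carrier) xs ys →
                             listSum g (cartesianProduct xs ys) ≈ listSum (λ x → listSum (λ y → g (x , y)) ys) xs
  listSum-cartesianProduct g []       ys = refl
  listSum-cartesianProduct g (x ∷ xs) ys =
    trans (listSum-++ g (Lists.map (x ,_) ys) _)
          (+-cong (listSum-map g (x ,_) ys) (listSum-cartesianProduct g xs ys))

  module _ {n : ℕ} (G : Graph (Fin n)) where
    open Graph G

    -- The adjacency matrix.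
    adjacent : Fin n → Fin n → Carrier
    adjacent u v = iverson (u ∼? v)

    adjacent-sym : ∀ u v → adjacent u v ≈ adjacent v u
    adjacent-sym u v = iverson-cong (u ∼? v) (v ∼? u) ∼-sym ∼-sym

    degree-sum : ∀ v → degree G v ×# 1# ≈ sum (adjacent v)
    degree-sum v = begin
      degree G v ×# 1#
        ≈⟨ length-listSum (filter (v ∼?_) (allFin n)) ⟩
      listSum (λ _ → 1#) (filter (v ∼?_) (allFin n))
        ≈⟨ listSum-filter (λ _ → 1#) (v ∼?_) (allFin n) ⟩
      listSum (λ w → adjacent v w * 1#) (allFin n)
        ≈⟨ listSum-tabulate (λ w → adjacent v w * 1#) id ⟩
      sum (λ w → adjacent v w * 1#)
        ≈⟨ sum-cong-≋ (λ w → *-identityʳ (adjacent v w)) ⟩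
      sum (adjacent v) ∎

    -- The endpoints of an edge.
    end₁ end₂ : Fin (size G) → Fin n
    end₁ e = proj₁ (lookup (edges G) e)
    end₂ e = proj₂ (lookup (edges G) e)

    private
      edge? : (p : Fin n × Fin n) → Dec (proj₁ p Fin.< proj₂ p × proj₁ p ∼ proj₂ p)
      edge? (u , v) = (u Fin.<? v) ×-dec (u ∼? v)

    ends-distinct : ∀ e → end₁ e ≢ end₂ e
    ends-distinct e = Fin.<⇒≢ (proj₁ (All.lookup (All.all-filter edge? (cartesianProduct (allFin n) (allFin n)))
                                        (∈-lookup {xs = edges G} e)))

    -- The vertex-edge incidence matrix.
    incidence : Fin n → Fin (size G) → Carrier
    incidence v e = iverson (incident? G v e)

    incidence-ends : ∀ v e → incidence v e ≈ δ v (end₁ e) + δ v (end₂ e)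
    incidence-ends v e = iverson-⊎ (v Fin.≟ end₁ e) (v Fin.≟ end₂ e)
      λ (v≡end₁ , v≡end₂) → ends-distinct e (≡.trans (≡.sym v≡end₁) v≡end₂)

    sum-edges : ∀ (g : Fin n → Fin n → Carrier) →
                sum (λ e → g (end₁ e) (end₂ e)) ≈ sum (λ u → sum (λ v → iverson (edge? (u , v)) * g u v))
    sum-edges g = begin
      sum (λ e → g (end₁ e) (end₂ e))
        ≈⟨ sum-lookup g′ (edges G) ⟩
      listSum g′ (edges G)
        ≈⟨ listSum-filter g′ edge? (cartesianProduct (allFin n) (allFin n)) ⟩
      listSum g″ (cartesianProduct (allFin n) (allFin n))
        ≈⟨ listSum-cartesianProduct g″ (allFin n) (allFin n) ⟩
      listSum (λ u → listSum (λ v → g″ (u , v)) (allFin n)) (allFin n)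
        ≈⟨ listSum-tabulate (λ u → listSum (λ v → g″ (u , v)) (allFin n)) id ⟩
      sum (λ u → listSum (λ v → g″ (u , v)) (allFin n))
        ≈⟨ sum-cong-≋ (λ u → listSum-tabulate (λ v → g″ (u , v)) id) ⟩
      sum (λ u → sum (λ v → g″ (u , v))) ∎
      where
      g′ g″ : Fin n × Fin n → Carrier
      g′ (u , v) = g u v
      g″ p       = iverson (edge? p) * g′ p

    -- Of the pairs (u , v) and (v , u) only one can be listed as an edge.
    adjacent-edge : ∀ u v → iverson (edge? (u , v)) + iverson (edge? (v , u)) ≈ adjacent u v
    adjacent-edge u v with Fin.<-cmp u v
    ... | tri< u<v _ v≮u = begin
      iverson (edge? (u , v)) + iverson (edge? (v , u))
        ≈⟨ +-cong (iverson-cong (edge? (u , v)) (u ∼? v) proj₂ (u<v ,_)) (iverson-no (edge? (v , u)) (v≮u ∘ proj₁)) ⟩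
      adjacent u v + 0#  ≈⟨ +-identityʳ _ ⟩
      adjacent u v       ∎
    ... | tri≈ u≮v u≡v v≮u = begin
      iverson (edge? (u , v)) + iverson (edge? (v , u))
        ≈⟨ +-cong (iverson-no (edge? (u , v)) (u≮v ∘ proj₁)) (iverson-no (edge? (v , u)) (v≮u ∘ proj₁)) ⟩
      0# + 0#            ≈⟨ +-identityʳ _ ⟩
      0#                 ≈⟨ iverson-no (u ∼? v) (∼-irrefl u≡v) ⟨
      adjacent u v       ∎
    ... | tri> u≮v _ v<u = begin
      iverson (edge? (u , v)) + iverson (edge? (v , u))
        ≈⟨ +-cong (iverson-no (edge? (u , v)) (u≮v ∘ proj₁)) 
                  (iverson-cong (edge? (v , u)) (u ∼? v) (∼-sym ∘ proj₂) λ u∼v → v<u , ∼-sym u∼v) ⟩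
      0# + adjacent u v  ≈⟨ +-identityˡ _ ⟩
      adjacent u v       ∎

    -- Summing over the edges at u is summing over the neighbours of u.
    sum-incidence : ∀ u (h : Fin n → Fin n → Carrier) → (∀ v w → h v w ≈ h w v) →
                    sum (λ e → incidence u e * h (end₁ e) (end₂ e)) ≈ sum (λ v → adjacent u v * h u v)
    sum-incidence u h h-sym = begin
      sum (λ e → incidence u e * h (end₁ e) (end₂ e))
        ≈⟨ sum-cong-≋ (λ e → *-congʳ (incidence-ends u e)) ⟩
      sum (λ e → (δ u (end₁ e) + δ u (end₂ e)) * h (end₁ e) (end₂ e))
        ≈⟨ sum-edges (λ a b → (δ u a + δ u b) * h a b) ⟩
      sum (λ a → sum (λ b → w a b * ((δ u a + δ u b) * h a b)))
        ≈⟨ sum-cong-≋ (λ a → trans (sum-cong-≋ (λ b → expand a b))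
             (∑-distrib-+ (λ b → δ u a * (w a b * h a b)) (λ b → δ u b * (w a b * h a b)))) ⟩
      sum (λ a → sum (λ b → δ u a * (w a b * h a b)) + sum (λ b → δ u b * (w a b * h a b)))
        ≈⟨ sum-cong-≋ (λ a → +-cong (sym (*-distribˡ-sum (δ u a) (λ b → w a b * h a b)))
                                    (sum-δˡ u (λ b → w a b * h a b))) ⟩
      sum (λ a → δ u a * sum (λ b → w a b * h a b) + w a u * h a u)
        ≈⟨ ∑-distrib-+ (λ a → δ u a * sum (λ b → w a b * h a b)) (λ a → w a u * h a u) ⟩
      sum (λ a → δ u a * sum (λ b → w a b * h a b)) + sum (λ a → w a u * h a u)
        ≈⟨ +-cong (sum-δˡ u (λ a → sum (λ b → w a b * h a b))) (sum-cong-≋ (λ a → *-congˡ (h-sym a u))) ⟩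
      sum (λ b → w u b * h u b) + sum (λ b → w b u * h u b)
        ≈⟨ ∑-distrib-+ (λ b → w u b * h u b) (λ b → w b u * h u b) ⟨
      sum (λ b → w u b * h u b + w b u * h u b)
        ≈⟨ sum-cong-≋ (λ b → trans (sym (distribʳ (h u b) (w u b) (w b u))) (*-congʳ (adjacent-edge u b))) ⟩
      sum (λ b → adjacent u b * h u b) ∎
      where
      open IntegerCoefficients R
      w : Fin n → Fin n → Carrier
      w a b = iverson (edge? (a , b))

      expand : ∀ a b → w a b * ((δ u a + δ u b) * h a b) ≈ δ u a * (w a b * h a b) + δ u b * (w a b * h a b)
      expand a b = solve 4 (λ w d e h → w :* ((d :+ e) :* h) := d :* (w :* h) :+ e :* (w :* h))
                         refl (w a b) (δ u a) (δ u b) (h a b)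

    incidence-rowSum : ∀ u → sum (incidence u) ≈ sum (adjacent u)
    incidence-rowSum u = begin
      sum (incidence u)               ≈⟨ sum-cong-≋ (λ e → *-identityʳ (incidence u e)) ⟨
      sum (λ e → incidence u e * 1#)  ≈⟨ sum-incidence u (λ _ _ → 1#) (λ _ _ → refl) ⟩
      sum (λ v → adjacent u v * 1#)   ≈⟨ sum-cong-≋ (λ v → *-identityʳ (adjacent u v)) ⟩
      sum (adjacent u)                ∎

    incidence-columnSum : ∀ e → sum (λ v → incidence v e) ≈ 1# + 1#
    incidence-columnSum e = begin
      sum (λ v → incidence v e)
        ≈⟨ sum-cong-≋ (λ v → trans (incidence-ends v e)
             (+-cong (trans (δ-sym v (end₁ e)) (sym (*-identityʳ _))) (trans (δ-sym v (end₂ e)) (sym (*-identityʳ _))))) ⟩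
      sum (λ v → δ (end₁ e) v * 1# + δ (end₂ e) v * 1#)
        ≈⟨ ∑-distrib-+ (λ v → δ (end₁ e) v * 1#) (λ v → δ (end₂ e) v * 1#) ⟩
      sum (λ v → δ (end₁ e) v * 1#) + sum (λ v → δ (end₂ e) v * 1#)
        ≈⟨ +-cong (sum-δˡ (end₁ e) (λ _ → 1#)) (sum-δˡ (end₂ e) (λ _ → 1#)) ⟩
      1# + 1# ∎

    -- The incidence matrix times its transpose is the signless Laplacian.
    incidence-gram : ∀ u v → sum (λ e → incidence u e * incidence v e) ≈ δ u v * sum (adjacent u) + adjacent u v
    incidence-gram u v = begin
      sum (λ e → incidence u e * incidence v e)
        ≈⟨ sum-cong-≋ (λ e → *-congˡ {incidence u e} (incidence-ends v e)) ⟩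
      sum (λ e → incidence u e * (δ v (end₁ e) + δ v (end₂ e)))
        ≈⟨ sum-incidence u (λ a b → δ v a + δ v b) (λ a b → +-comm (δ v a) (δ v b)) ⟩
      sum (λ w → adjacent u w * (δ v u + δ v w))
        ≈⟨ sum-cong-≋ (λ w → trans (distribˡ (adjacent u w) (δ v u) (δ v w))
             (+-cong (trans (*-congˡ (δ-sym v u)) (*-comm _ _)) (*-comm _ _))) ⟩
      sum (λ w → δ u v * adjacent u w + δ v w * adjacent u w)
        ≈⟨ ∑-distrib-+ (λ w → δ u v * adjacent u w) (λ w → δ v w * adjacent u w) ⟩
      sum (λ w → δ u v * adjacent u w) + sum (λ w → δ v w * adjacent u w)
        ≈⟨ +-cong (sym (*-distribˡ-sum (δ u v) (adjacent u))) (sum-δˡ v (adjacent u)) ⟩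
      δ u v * sum (adjacent u) + adjacent u v ∎

------------------------------------------------------------------------
-- The Laplacian matrix of a central vertex corona

module LaplacianMatrix {c ℓ₁ ℓ₂} (K : OrderedField c ℓ₁ ℓ₂) where
  open OrderedField K hiding (zero)
  open import Algebra.Properties.Ring ring
  open import Algebra.Properties.Semiring.Mult semiring using () renaming (_×_ to _×#_)
  open IntegerCoefficients commutativeRing
  open Determinants commutativeRing
  open IversonBrackets commutativeRing
  open OrderedFieldProperties K
  open Spectral K using (laplacian; degreeMatrix)
  open SetoidReasoning setoid

  degreeMatrix-sum : ∀ {n} (G : Graph (Fin n)) i j → degreeMatrix G i j ≈ δ i j * sum (adjacent G i)
  degreeMatrix-sum G i j with does (i Fin.≟ j)
  ... | true  = trans (degree-sum G i) (sym (*-identityˡ _))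
  ... | false = sym (zeroˡ _)

  laplacian-entry : ∀ {n} (G : Graph (Fin n)) i j → laplacian G i j ≈ δ i j * sum (adjacent G i) - adjacent G i j
  laplacian-entry G i j = +-congʳ (degreeMatrix-sum G i j)

  laplacian-rowSum : ∀ {n} (G : Graph (Fin n)) i → sum (laplacian G i) ≈ 0#
  laplacian-rowSum G i = begin
    sum (laplacian G i)
      ≈⟨ sum-cong-≋ (λ j → trans (laplacian-entry G i j) (+-congˡ (sym (-1*x≈-x (adjacent G i j))))) ⟩
    sum (λ j → δ i j * sum (adjacent G i) + - 1# * adjacent G i j)
      ≈⟨ ∑-distrib-+ (λ j → δ i j * sum (adjacent G i)) (λ j → - 1# * adjacent G i j) ⟩
    sum (λ j → δ i j * sum (adjacent G i)) + sum (λ j → - 1# * adjacent G i j)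
      ≈⟨ +-cong (sum-δˡ i (λ _ → sum (adjacent G i)))
                (trans (sym (*-distribˡ-sum (- 1#) (adjacent G i))) (-1*x≈-x _)) ⟩
    sum (adjacent G i) - sum (adjacent G i)
      ≈⟨ -‿inverseʳ _ ⟩
    0# ∎

  laplacian-sym : ∀ {n} (G : Graph (Fin n)) i j → laplacian G i j ≈ laplacian G j i
  laplacian-sym G i j = begin
    laplacian G i j                                   ≈⟨ laplacian-entry G i j ⟩
    δ i j * sum (adjacent G i) - adjacent G i j       ≈⟨ +-cong degreePart (-‿cong (adjacent-sym G i j)) ⟩
    δ j i * sum (adjacent G j) - adjacent G j i       ≈⟨ laplacian-entry G j i ⟨
    laplacian G j i                                   ∎
    where
    degreePart : δ i j * sum (adjacent G i) ≈ δ j i * sum (adjacent G j)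
    degreePart with i Fin.≟ j
    ... | yes ≡.refl = *-congʳ (sym (δ-refl i))
    ... | no  i≢j    = trans (zeroˡ _) (sym (trans (*-congʳ (iverson-no (j Fin.≟ i) (i≢j ∘ ≡.sym))) (zeroˡ _)))

  adjacent≥0 : ∀ {n} (G : Graph (Fin n)) i j → NonNegative (adjacent G i j)
  adjacent≥0 G i j with does (Graph._∼?_ G i j)
  ... | true  = proj₁ positive-1
  ... | false = ≤-reflexive refl

  laplacian-offDiagonal : ∀ {n} (G : Graph (Fin n)) i j → i ≢ j → NonNegative (- laplacian G i j)
  laplacian-offDiagonal G i j i≢j with i Fin.≟ j
  ... | yes i≡j = contradiction i≡j i≢j
  ... | no  _   = ≤-respʳ (solve 1 (λ a → a := :- (con (+ 0) :- a)) refl (adjacent G i j)) (adjacent≥0 G i j)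

  shifted-laplacian : ∀ {n} (G : Graph (Fin n)) x i j →
                      shifted x (laplacian G) i j ≈ δ i j * (x - sum (adjacent G i)) + adjacent G i j
  shifted-laplacian G x i j = begin
    x * δ i j - laplacian G i j
      ≈⟨ +-congˡ (-‿cong (laplacian-entry G i j)) ⟩
    x * δ i j - (δ i j * sum (adjacent G i) - adjacent G i j)
      ≈⟨ solve 4 (λ x d s a → x :* d :- (d :* s :- a) := d :* (x :- s) :+ a) refl x (δ i j) (sum (adjacent G i)) (adjacent G i j) ⟩
    δ i j * (x - sum (adjacent G i)) + adjacent G i j ∎

module CoronaDeterminant {c ℓ₁ ℓ₂} (K : OrderedField c ℓ₁ ℓ₂)
    {n₁ n₂ : ℕ} (G₁ : Graph (Fin n₁)) (G₂ : Graph (Fin n₂)) where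
  open OrderedField K hiding (zero)
  open import Algebra.Properties.Ring ring
  open import Algebra.Properties.Semiring.Mult semiring using () renaming (_×_ to _×#_)
  open import Algebra.Properties.Semiring.Exp semiring using (_^_)
  open IntegerCoefficients commutativeRing
  open Determinants commutativeRing
  open SpecialDeterminants commutativeRing
  open IversonBrackets commutativeRing
  open OrderedFieldProperties K
  open LaplacianMatrix K
  open Spectral K using (laplacian)
  open SetoidReasoning setoid

  private
    module Γ = Graph (centralVertexCorona G₁ G₂)
    V   = CoronaVertex G₁ G₂
    m₁  = size G₁
    N₁  = n₁ ×# 1#
    N₂  = n₂ ×# 1#
    A   = adjacent G₁
    R   = incidence G₁
    d₁  = λ i → sum (A i)
    d₂  = λ u → sum (adjacent G₂ u)

  -- The vertices of G₁, the vertices that subdivide its edges, and the vertices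
  -- of the copies of G₂.
  pattern vertex i    = inj₁ (inj₁ i)
  pattern midpoint e  = inj₁ (inj₂ e)
  pattern copied i u  = inj₂ (i , u)

  _≟ⱽ_ : DecidableEquality V
  _≟ⱽ_ = Sum.≡-dec (Sum.≡-dec Fin._≟_ Fin._≟_) (Product.≡-dec Fin._≟_ Fin._≟_)

  -- The vertex at a given position of the first or second block, where the second
  -- one holds the copies.
  index : Fin (n₁ ℕ.+ m₁) ⊎ Fin (n₁ ℕ.* n₂) → V
  index = Sum.map (splitAt n₁) (remQuot n₂)

  -- The numbering of the vertices that defines G₁ ⊙ G₂.
  enumeration : Fin ((n₁ ℕ.+ m₁) ℕ.+ n₁ ℕ.* n₂) ↔ V
  enumeration = (Fin.+↔⊎ ⊎-↔ Fin.*↔×) ↔-∘ Fin.+↔⊎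

  vertexAt : Fin ((n₁ ℕ.+ m₁) ℕ.+ n₁ ℕ.* n₂) → V
  vertexAt p = index (splitAt (n₁ ℕ.+ m₁) p)

  vertexAt-injective : ∀ {p q} → vertexAt p ≡ vertexAt q → p ≡ q
  vertexAt-injective {p} {q} eq =
    ≡.trans (≡.sym (inverseʳ ≡.refl)) (≡.trans (≡.cong from eq) (inverseʳ ≡.refl))
    where open Inverse enumeration

  -- The sum over all vertices of the corona.
  sumⱽ : (V → Carrier) → Carrier
  sumⱽ f = (sum (λ i → f (vertex i)) + sum (λ e → f (midpoint e))) + sum (λ i → sum (λ u → f (copied i u)))

  sum-vertexAt : ∀ f → sum (f ∘ vertexAt) ≈ sumⱽ f
  sum-vertexAt f = trans (sum-splitAt (n₁ ℕ.+ m₁) (f ∘ index))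
    (+-cong (sum-splitAt n₁ (f ∘ inj₁)) (sum-remQuot n₁ (f ∘ inj₂)))

  adjacentⱽ : V → V → Carrier
  adjacentⱽ s t = iverson (s Γ.∼? t)

  degreeⱽ : V → Carrier
  degreeⱽ s = sumⱽ (adjacentⱽ s)

  sum-sub : ∀ {n} (f g : Vector Carrier n) → sum (λ i → f i - g i) ≈ sum f - sum g
  sum-sub f g = begin
    sum (λ i → f i - g i)            ≈⟨ sum-cong-≋ (λ i → +-congˡ (sym (-1*x≈-x (g i)))) ⟩
    sum (λ i → f i + - 1# * g i)     ≈⟨ ∑-distrib-+ f (λ i → - 1# * g i) ⟩
    sum f + sum (λ i → - 1# * g i)   ≈⟨ +-congˡ (trans (sym (*-distribˡ-sum (- 1#) g)) (-1*x≈-x _)) ⟩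
    sum f - sum g                    ∎

  sum-δ : ∀ {n} (i : Fin n) → sum (δ i) ≈ 1#
  sum-δ i = trans (sum-cong-≋ λ j → sym (*-identityʳ (δ i j))) (sum-δˡ i (λ _ → 1#))

  nonadjacent : ∀ i j → adjacentⱽ (vertex i) (vertex j) ≈ 1# - δ i j - A i j
  nonadjacent i j with i Fin.≟ j
  ... | yes ≡.refl = begin
    0#              ≈⟨ solve 0 (con (+ 0) := con (+ 1) :- con (+ 1) :- con (+ 0)) refl ⟩
    1# - 1# - 0#    ≈⟨ +-congˡ (-‿cong (iverson-no (Graph._∼?_ G₁ i i) (Graph.∼-irrefl G₁ ≡.refl))) ⟨
    1# - 1# - A i i ∎
  ... | no _ = trans (iverson-¬ (Graph._∼?_ G₁ i j)) (+-congʳ (solve 0 (con (+ 1) := con (+ 1) :- con (+ 0)) refl))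

  -- The d₁ i edges at i are subdivided, and i is joined to its n₁ - 1 - d₁ i
  -- nonneighbours, so the degree of i in the central graph is n₁ - 1.
  degree-vertex : ∀ i → degreeⱽ (vertex i) ≈ N₁ - 1# + N₂
  degree-vertex i = begin
    (sum (λ j → adjacentⱽ (vertex i) (vertex j)) + sum (R i)) + sum (λ j → sum {n₂} (λ _ → δ i j))
      ≈⟨ +-cong (+-cong nonneighbours (incidence-rowSum G₁ i)) copies ⟩
    (N₁ - 1# - d₁ i + d₁ i) + N₂
      ≈⟨ solve 3 (λ a b d → (a :- con (+ 1) :- d :+ d) :+ b := a :- con (+ 1) :+ b) refl N₁ N₂ (d₁ i) ⟩
    N₁ - 1# + N₂ ∎
    where
    nonneighbours : sum (λ j → adjacentⱽ (vertex i) (vertex j)) ≈ N₁ - 1# - d₁ i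
    nonneighbours = begin
      sum (λ j → adjacentⱽ (vertex i) (vertex j))  ≈⟨ sum-cong-≋ (nonadjacent i) ⟩
      sum (λ j → 1# - δ i j - A i j)               ≈⟨ sum-sub (λ j → 1# - δ i j) (A i) ⟩
      sum (λ j → 1# - δ i j) - d₁ i                ≈⟨ +-congʳ (sum-sub (λ _ → 1#) (δ i)) ⟩
      sum {n₁} (λ _ → 1#) - sum (δ i) - d₁ i       ≈⟨ +-congʳ (+-cong (sum-replicate n₁) (-‿cong (sum-δ i))) ⟩
      N₁ - 1# - d₁ i                               ∎

    copies : sum (λ j → sum {n₂} (λ _ → δ i j)) ≈ N₂
    copies = begin
      sum (λ j → sum {n₂} (λ _ → δ i j))
        ≈⟨ sum-cong-≋ (λ j → trans (sum-cong-≋ {n₂} λ _ → sym (*-identityʳ (δ i j)))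
             (sym (*-distribˡ-sum {n₂} (δ i j) (λ _ → 1#)))) ⟩
      sum (λ j → δ i j * sum {n₂} (λ _ → 1#))
        ≈⟨ sum-δˡ i (λ _ → sum {n₂} (λ _ → 1#)) ⟩
      sum {n₂} (λ _ → 1#)
        ≈⟨ sum-replicate n₂ ⟩
      N₂ ∎

  degree-midpoint : ∀ e → degreeⱽ (midpoint e) ≈ 1# + 1#
  degree-midpoint e = begin
    (sum (λ i → R i e) + sum {m₁} (λ _ → 0#)) + sum {n₁} (λ _ → sum {n₂} (λ _ → 0#))
      ≈⟨ +-cong (+-cong (incidence-columnSum G₁ e) (sum-replicate-zero m₁))
                (sum-zero {n₁} (λ _ → sum {n₂} (λ _ → 0#)) (λ _ → sum-replicate-zero n₂)) ⟩
    (1# + 1# + 0#) + 0#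
      ≈⟨ trans (+-identityʳ _) (+-identityʳ _) ⟩
    1# + 1# ∎

  adjacent-copied : ∀ i u j v → adjacentⱽ (copied i u) (copied j v) ≈ δ i j * adjacent G₂ u v
  adjacent-copied i u j v = iverson-× (i Fin.≟ j) (Graph._∼?_ G₂ u v)

  degree-copied : ∀ i u → degreeⱽ (copied i u) ≈ 1# + d₂ u
  degree-copied i u = begin
    (sum (λ j → δ j i) + sum {m₁} (λ _ → 0#)) + sum (λ j → sum (λ v → adjacentⱽ (copied i u) (copied j v)))
      ≈⟨ +-cong (+-cong (trans (sum-cong-≋ λ j → δ-sym j i) (sum-δ i)) (sum-replicate-zero m₁)) copy ⟩
    (1# + 0#) + d₂ u
      ≈⟨ +-congʳ (+-identityʳ 1#) ⟩
    1# + d₂ u ∎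
    where
    copy : sum (λ j → sum (λ v → adjacentⱽ (copied i u) (copied j v))) ≈ d₂ u
    copy = begin
      sum (λ j → sum (λ v → adjacentⱽ (copied i u) (copied j v)))
        ≈⟨ sum-cong-≋ (λ j → trans (sum-cong-≋ (adjacent-copied i u j)) (sym (*-distribˡ-sum (δ i j) (adjacent G₂ u)))) ⟩
      sum (λ j → δ i j * d₂ u)
        ≈⟨ sum-δˡ i (λ _ → d₂ u) ⟩
      d₂ u ∎

  module _ (x : Carrier) where

    -- The matrix x I - L of the corona, indexed by its vertices.
    corona : V → V → Carrier
    corona (vertex i)   (vertex j)   = δ i j * (x - N₁ - N₂) + 1# - A i j
    corona (vertex i)   (midpoint e) = R i e
    corona (vertex i)   (copied j v) = δ i j
    corona (midpoint e) (vertex j)   = R j e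
    corona (midpoint e) (midpoint f) = (x - (1# + 1#)) * δ e f
    corona (midpoint e) (copied j v) = 0#
    corona (copied i u) (vertex j)   = δ j i
    corona (copied i u) (midpoint f) = 0#
    corona (copied i u) (copied j v) = δ i j * shifted (x - 1#) (laplacian G₂) u v

    corona-entry : ∀ s t → iverson (s ≟ⱽ t) * (x - degreeⱽ s) + adjacentⱽ s t ≈ corona s t
    corona-entry (vertex i)   (vertex j)   = begin
      δ i j * (x - degreeⱽ (vertex i)) + adjacentⱽ (vertex i) (vertex j)
        ≈⟨ +-cong (*-congˡ (+-congˡ (-‿cong (degree-vertex i)))) (nonadjacent i j) ⟩
      δ i j * (x - (N₁ - 1# + N₂)) + (1# - δ i j - A i j)
        ≈⟨ solve 5 (λ d x a b c → d :* (x :- (a :- con (+ 1) :+ b)) :+ (con (+ 1) :- d :- c) := d :* (x :- a :- b) :+ con (+ 1) :- c)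
                 refl (δ i j) x N₁ N₂ (A i j) ⟩
      δ i j * (x - N₁ - N₂) + 1# - A i j ∎
    corona-entry (vertex i)   (midpoint e) = trans (+-congʳ (zeroˡ _)) (+-identityˡ _)
    corona-entry (vertex i)   (copied j v) = trans (+-congʳ (zeroˡ _)) (+-identityˡ _)
    corona-entry (midpoint e) (vertex j)   = trans (+-congʳ (zeroˡ _)) (+-identityˡ _)
    corona-entry (midpoint e) (midpoint f) = trans (+-identityʳ _)
      (trans (*-congˡ (+-congˡ (-‿cong (degree-midpoint e)))) (*-comm _ _))
    corona-entry (midpoint e) (copied j v) = trans (+-congʳ (zeroˡ _)) (+-identityˡ _)
    corona-entry (copied i u) (vertex j)   = trans (+-congʳ (zeroˡ _)) (+-identityˡ _)
    corona-entry (copied i u) (midpoint f) = trans (+-congʳ (zeroˡ _)) (+-identityˡ _)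
    corona-entry (copied i u) (copied j v) = begin
      iverson (copied i u ≟ⱽ copied j v) * (x - degreeⱽ (copied i u)) + adjacentⱽ (copied i u) (copied j v)
        ≈⟨ +-cong (*-cong δδ (+-congˡ (-‿cong (degree-copied i u)))) (adjacent-copied i u j v) ⟩
      (δ i j * δ u v) * (x - (1# + d₂ u)) + δ i j * adjacent G₂ u v
        ≈⟨ solve 5 (λ d e x s a → (d :* e) :* (x :- (con (+ 1) :+ s)) :+ d :* a := d :* (e :* (x :- con (+ 1) :- s) :+ a))
                 refl (δ i j) (δ u v) x (d₂ u) (adjacent G₂ u v) ⟩
      δ i j * (δ u v * (x - 1# - d₂ u) + adjacent G₂ u v)
        ≈⟨ *-congˡ (shifted-laplacian G₂ (x - 1#) u v) ⟨
      δ i j * shifted (x - 1#) (laplacian G₂) u v ∎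
      where
      δδ : iverson (copied i u ≟ⱽ copied j v) ≈ δ i j * δ u v
      δδ = trans (iverson-cong (copied i u ≟ⱽ copied j v) ((i Fin.≟ j) ×-dec (u Fin.≟ v))
                   (λ { ≡.refl → ≡.refl , ≡.refl }) (λ { (≡.refl , ≡.refl) → ≡.refl }))
                 (iverson-× (i Fin.≟ j) (u Fin.≟ v))

    shifted-corona : ∀ p q → shifted x (laplacian (G₁ ⊙ G₂)) p q ≈ corona (vertexAt p) (vertexAt q)
    shifted-corona p q = begin
      shifted x (laplacian (G₁ ⊙ G₂)) p q
        ≈⟨ shifted-laplacian (G₁ ⊙ G₂) x p q ⟩
      δ p q * (x - sum (adjacentⱽ (vertexAt p) ∘ vertexAt)) + adjacentⱽ (vertexAt p) (vertexAt q)
        ≈⟨ +-congʳ (*-cong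
             (iverson-cong (p Fin.≟ q) (vertexAt p ≟ⱽ vertexAt q) (≡.cong vertexAt) vertexAt-injective)
             (+-congˡ (-‿cong (sum-vertexAt (adjacentⱽ (vertexAt p)))))) ⟩
      iverson (vertexAt p ≟ⱽ vertexAt q) * (x - degreeⱽ (vertexAt p)) + adjacentⱽ (vertexAt p) (vertexAt q)
        ≈⟨ corona-entry (vertexAt p) (vertexAt q) ⟩
      corona (vertexAt p) (vertexAt q) ∎

    module _ {y⁻¹ d⁻¹ : Carrier} (y-inverse : (x - 1#) * y⁻¹ ≈ 1#) (d-inverse : (x - (1# + 1#)) * d⁻¹ ≈ 1#) where
      private
        y = x - 1#
        d = x - (1# + 1#)
        E = shifted y (laplacian G₂)
        B₁ : BlockMatrix (n₁ ℕ.+ m₁) (n₁ ℕ.* n₂)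
        B₁ s t = corona (index s) (index t)

        -- The upper right block times the inverse of I ⊗ E, whose columns sum
        -- to y just as those of E.
        W₁ : Fin n₁ ⊎ Fin m₁ → Fin n₁ × Fin n₂ → Carrier
        W₁ s (j , v) = y⁻¹ * corona (inj₁ s) (copied j v)

      E-columnSum : ∀ v → sum (λ u → E u v) ≈ y
      E-columnSum v = begin
        sum (λ u → y * δ u v - laplacian G₂ u v)
          ≈⟨ sum-sub (λ u → y * δ u v) (λ u → laplacian G₂ u v) ⟩
        sum (λ u → y * δ u v) - sum (λ u → laplacian G₂ u v)
          ≈⟨ +-cong (sum-δʳ (λ _ → y) v)
                    (-‿cong (trans (sum-cong-≋ λ u → laplacian-sym G₂ u v) (laplacian-rowSum G₂ v))) ⟩
        y - 0#
          ≈⟨ trans (+-congˡ -0#≈0#) (+-identityʳ y) ⟩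
        y ∎

      W₁-solves : ∀ s j v → sum (λ i → sum (λ u → W₁ s (i , u) * corona (copied i u) (copied j v)))
                          ≈ corona (inj₁ s) (copied j v)
      W₁-solves (inj₂ e) j v = sum-zero (λ i → sum (λ u → (y⁻¹ * 0#) * (δ i j * E u v)))
        λ i → sum-zero (λ u → (y⁻¹ * 0#) * (δ i j * E u v)) λ u → trans (*-congʳ (zeroʳ y⁻¹)) (zeroˡ _)
      W₁-solves (inj₁ k) j v = begin
        sum (λ i → sum (λ u → (y⁻¹ * δ k i) * (δ i j * E u v)))
          ≈⟨ sum-cong-≋ (λ i → trans
               (sum-cong-≋ λ u → solve 4 (λ w a b e → (w :* a) :* (b :* e) := (a :* (w :* b)) :* e) refl y⁻¹ (δ k i) (δ i j) (E u v))
               (trans (sym (*-distribˡ-sum (δ k i * (y⁻¹ * δ i j)) (λ u → E u v))) (*-congˡ (E-columnSum v)))) ⟩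
        sum (λ i → (δ k i * (y⁻¹ * δ i j)) * y)
          ≈⟨ sum-cong-≋ (λ i → trans
               (solve 4 (λ a w b y → (a :* (w :* b)) :* y := a :* ((y :* w) :* b)) refl (δ k i) y⁻¹ (δ i j) y)
               (*-congˡ {δ k i} (trans (*-congʳ y-inverse) (*-identityˡ (δ i j))))) ⟩
        sum (λ i → δ k i * δ i j)
          ≈⟨ sum-δˡ k (λ i → δ i j) ⟩
        δ k j ∎

      -- The Schur complement of the copies.
      B₂ : BlockMatrix n₁ m₁
      B₂ (inj₁ i) (inj₁ j) = corona (vertex i) (vertex j) - δ i j * (N₂ * y⁻¹)
      B₂ s        t        = corona (inj₁ s) (inj₁ t)

      complement₁ : ∀ s t → corona (inj₁ s) (inj₁ t)
                              - sum (λ i → sum (λ u → W₁ s (i , u) * corona (copied i u) (inj₁ t)))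
                            ≈ B₂ s t
      complement₁ (inj₁ i) (inj₁ j) = +-congˡ (-‿cong (begin
        sum (λ k → sum {n₂} (λ _ → (y⁻¹ * δ i k) * δ j k))
          ≈⟨ sum-cong-≋ (λ k → trans
               (sum-cong-≋ {n₂} λ _ → solve 3 (λ w a b → (w :* a) :* b := (a :* (w :* b)) :* con (+ 1)) refl y⁻¹ (δ i k) (δ j k))
               (trans (sym (*-distribˡ-sum {n₂} (δ i k * (y⁻¹ * δ j k)) (λ _ → 1#))) (*-congˡ (sum-replicate n₂)))) ⟩
        sum (λ k → (δ i k * (y⁻¹ * δ j k)) * N₂)
          ≈⟨ sum-cong-≋ (λ k → *-assoc (δ i k) (y⁻¹ * δ j k) N₂) ⟩
        sum (λ k → δ i k * ((y⁻¹ * δ j k) * N₂))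
          ≈⟨ sum-δˡ i (λ k → (y⁻¹ * δ j k) * N₂) ⟩
        (y⁻¹ * δ j i) * N₂
          ≈⟨ *-congʳ (*-congˡ (δ-sym j i)) ⟩
        (y⁻¹ * δ i j) * N₂
          ≈⟨ solve 3 (λ w a b → (w :* a) :* b := a :* (b :* w)) refl y⁻¹ (δ i j) N₂ ⟩
        δ i j * (N₂ * y⁻¹) ∎))
      complement₁ (inj₁ i) (inj₂ f) = subtractZero (sum-zero (λ k → sum {n₂} (λ u → (y⁻¹ * δ i k) * 0#))
        λ k → sum-zero {n₂} (λ u → (y⁻¹ * δ i k) * 0#) λ u → zeroʳ _)
        where
        subtractZero : ∀ {a b} → b ≈ 0# → a - b ≈ a
        subtractZero b≈0 = trans (+-congˡ (trans (-‿cong b≈0) -0#≈0#)) (+-identityʳ _)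
      complement₁ (inj₂ e) t = trans (+-congˡ (trans (-‿cong (sum-zero (λ k → sum (λ u → (y⁻¹ * 0#) * corona (copied k u) (inj₁ t)))
        λ k → sum-zero {n₂} (λ u → (y⁻¹ * 0#) * corona (copied k u) (inj₁ t)) λ u → trans (*-congʳ (zeroʳ y⁻¹)) (zeroˡ _))) -0#≈0#))
        (trans (+-identityʳ _) (B₂-midpoint t))
        where
        B₂-midpoint : ∀ t → corona (midpoint e) (inj₁ t) ≈ B₂ (inj₂ e) t
        B₂-midpoint (inj₁ j) = refl
        B₂-midpoint (inj₂ f) = refl

      -- Eliminating the copies of G₂.
      det-copies : det (shifted x (laplacian (G₁ ⊙ G₂))) ≈ det (flatten B₂) * det E ^ n₁
      det-copies = begin
        det (shifted x (laplacian (G₁ ⊙ G₂)))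
          ≈⟨ det-cong shifted-corona ⟩
        det (flatten B₁)
          ≈⟨ det-Schur B₁ (λ p q → W₁ (splitAt n₁ p) (remQuot n₂ q))
               (λ p q → trans (sum-remQuot n₁ (λ r → W₁ (splitAt n₁ p) r * corona (inj₂ r) (inj₂ (remQuot n₂ q))))
                              (W₁-solves (splitAt n₁ p) (proj₁ (remQuot {n₁} n₂ q)) (proj₂ (remQuot {n₁} n₂ q)))) ⟩
        det (λ p q → corona (inj₁ (splitAt n₁ p)) (inj₁ (splitAt n₁ q))
                     - sum (λ r → W₁ (splitAt n₁ p) (remQuot n₂ r) * corona (inj₂ (remQuot n₂ r)) (inj₁ (splitAt n₁ q))))
          * det (λ p q → corona (inj₂ (remQuot n₂ p)) (inj₂ (remQuot n₂ q)))
          ≈⟨ *-cong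
               (det-cong λ p q → trans
                 (+-congˡ (-‿cong (sum-remQuot n₁ (λ r → W₁ (splitAt n₁ p) r * corona (inj₂ r) (inj₁ (splitAt n₁ q))))))
                 (complement₁ (splitAt n₁ p) (splitAt n₁ q)))
               (det-blockDiagonal n₁ E (λ r s → corona (inj₂ r) (inj₂ s)) (λ i u j v → refl)) ⟩
        det (flatten B₂) * det E ^ n₁ ∎

      -- Eliminating the vertices that subdivide edges.
      det-midpoints : det (flatten B₂) ≈
        det (λ i j → (x - N₁ - N₂ - N₂ * y⁻¹ - d₁ i * d⁻¹) * δ i j - (1# + d⁻¹) * A i j + 1#) * d ^ m₁
      det-midpoints = begin
        det (flatten B₂)
          ≈⟨ det-Schur B₂ (λ i e → R i e * d⁻¹) solves ⟩
        det (λ i j → B₂ (inj₁ i) (inj₁ j) - sum (λ e → (R i e * d⁻¹) * R j e))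
          * det {m₁} (λ e f → d * δ e f)
          ≈⟨ *-cong (det-cong entry) (det-scalar m₁ d) ⟩
        det (λ i j → (x - N₁ - N₂ - N₂ * y⁻¹ - d₁ i * d⁻¹) * δ i j - (1# + d⁻¹) * A i j + 1#) * d ^ m₁ ∎
        where
        solves : ∀ i f → sum (λ e → (R i e * d⁻¹) * (d * δ e f)) ≈ R i f
        solves i f = trans (sum-cong-≋ λ e → trans
          (solve 4 (λ r w d a → (r :* w) :* (d :* a) := (r :* (d :* w)) :* a) refl (R i e) d⁻¹ d (δ e f))
          (*-congʳ (trans (*-congˡ d-inverse) (*-identityʳ (R i e)))))
          (sum-δʳ (R i) f)

        entry : ∀ i j → B₂ (inj₁ i) (inj₁ j) - sum (λ e → (R i e * d⁻¹) * R j e)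
                        ≈ (x - N₁ - N₂ - N₂ * y⁻¹ - d₁ i * d⁻¹) * δ i j - (1# + d⁻¹) * A i j + 1#
        entry i j = begin
          (δ i j * (x - N₁ - N₂) + 1# - A i j) - δ i j * (N₂ * y⁻¹) - sum (λ e → (R i e * d⁻¹) * R j e)
            ≈⟨ +-congˡ (-‿cong (begin
                 sum (λ e → (R i e * d⁻¹) * R j e)
                   ≈⟨ sum-cong-≋ (λ e → solve 3 (λ a w b → (a :* w) :* b := (a :* b) :* w) refl (R i e) d⁻¹ (R j e)) ⟩
                 sum (λ e → (R i e * R j e) * d⁻¹)
                   ≈⟨ *-distribʳ-sum d⁻¹ (λ e → R i e * R j e) ⟨
                 sum (λ e → R i e * R j e) * d⁻¹
                   ≈⟨ *-congʳ (incidence-gram G₁ i j) ⟩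
                 (δ i j * d₁ i + A i j) * d⁻¹ ∎)) ⟩
          (δ i j * (x - N₁ - N₂) + 1# - A i j) - δ i j * (N₂ * y⁻¹) - (δ i j * d₁ i + A i j) * d⁻¹
            ≈⟨ solve 8 (λ δ x a b y r w A → (δ :* (x :- a :- b) :+ con (+ 1) :- A) :- δ :* (b :* y) :- (δ :* r :+ A) :* w
                        := (x :- a :- b :- b :* y :- r :* w) :* δ :- (con (+ 1) :+ w) :* A :+ con (+ 1))
                     refl (δ i j) x N₁ N₂ y⁻¹ (d₁ i) d⁻¹ (A i j) ⟩
          (x - N₁ - N₂ - N₂ * y⁻¹ - d₁ i * d⁻¹) * δ i j - (1# + d⁻¹) * A i j + 1# ∎

------------------------------------------------------------------------
-- The Laplacian characteristic polynomial of the corona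

module CoronaPolynomial {c ℓ₁ ℓ₂} (K : OrderedField c ℓ₁ ℓ₂) where
  open OrderedField K hiding (zero; _-_)
  open Lists using ([]; _∷_)
  open CommutativeRing commutativeRing using () renaming (_-_ to _-#_)
  open import Algebra.Properties.Ring ring
  open import Algebra.Properties.Semiring.Mult semiring using () renaming (_×_ to _×#_)
  open import Algebra.Properties.Semiring.Exp semiring using (^-congˡ) renaming (_^_ to _^#_)
  open import Algebra.Properties.CommutativeSemiring.Exp commutativeSemiring using (^-distrib-*)
  open RawSemiringDefinitions (RawRing.rawSemiring rawRing) using () renaming (product to product#)
  open IntegerCoefficients commutativeRing
  open Determinants commutativeRing
  open SpecialDeterminants commutativeRing
  open IversonBrackets commutativeRing
  open OrderedFieldProperties K hiding (*-≉0)
  open LaplacianMatrix K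
  open Evaluation K
  open Spectral K hiding (_+_; _*_)
  open Spectral K using () renaming (_+_ to _+ₚ_; _*_ to _*ₚ_)
  open RatFun
  open SetoidReasoning setoid

  -- Adding 1 to all entries of a matrix with constant column sums s.  Both
  -- determinants are multiples of the one whose row 0 is replaced by ones, and
  -- that one is q.
  det-+ones : ∀ {n} s (M : Matrix (suc n)) → (∀ j → sum (λ i → M i j) ≈ s) →
              ∀ q → s ≉ 0# → det M ≈ s * q → det (λ i j → M i j + 1#) ≈ (s + suc n ×# 1#) * q
  det-+ones {n} s M columnSum q s≉0 det≈sq = begin
    det (λ i j → M i j + 1#)
      ≈⟨ det-columnSums (s + suc n ×# 1#) (λ i j → M i j + 1#) (λ j →
           trans (∑-distrib-+ (λ i → M i j) (λ _ → 1#)) (+-cong (columnSum j) (sum-replicate (suc n)))) ⟩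
    (s + suc n ×# 1#) * det ((λ _ → 1#) Vector.∷ λ i j → M (suc i) j + 1#)
      ≈⟨ *-congˡ (det-+constant 1# M) ⟩
    (s + suc n ×# 1#) * det ((λ _ → 1#) Vector.∷ tail M)
      ≈⟨ *-congˡ (*-cancelˡ s≉0 (trans (sym (det-columnSums s M columnSum)) det≈sq)) ⟩
    (s + suc n ×# 1#) * q ∎


  -- The polynomial p takes the value v at x.  As a record, it lets p and v be
  -- inferred when the value of a compound polynomial is put together.
  record Value (x : Carrier) (p : Poly) (v : Carrier) : Set ℓ₁ where
    constructor value
    field at : eval p x ≈ v
  open Value public

  infixl 6 _⊞_ _⊟_
  infixl 7 _⊠_
  infixr 8 _⊡_

  _⊞_ : ∀ {x p q a b} → Value x p a → Value x q b → Value x (p +ₚ q) (a + b)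
  _⊞_ {x} {p} {q} u v = value (trans (eval-+ x p q) (+-cong (at u) (at v)))

  _⊟_ : ∀ {x p q a b} → Value x p a → Value x q b → Value x (p - q) (a -# b)
  _⊟_ {x} {p} {q} u v = value (trans (eval-- x p q) (+-cong (at u) (-‿cong (at v))))

  _⊠_ : ∀ {x p q a b} → Value x p a → Value x q b → Value x (p *ₚ q) (a * b)
  _⊠_ {x} {p} {q} u v = value (trans (eval-* x p q) (*-cong (at u) (at v)))

  _⊡_ : ∀ {x p a} → Value x p a → ∀ k → Value x (p ^ k) (a ^# k)
  _⊡_ {x} {p} u k = value (trans (eval-^ x p k) (^-congˡ k (at u)))

  valueX : ∀ x → Value x X x
  valueX x = value (eval-X x)

  valueC : ∀ x a → Value x (C a) a
  valueC x a = value (eval-C x a)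

  valueN : ∀ x k → Value x (nat k) (k ×# 1#)
  valueN x k = valueC x (k ×# 1#)

  valueProduct : ∀ x {n} {f : Vector Poly n} {a : Vector Carrier n} → (∀ i → Value x (f i) (a i)) →
                 Value x (product f) (product# a)
  valueProduct x {f = f} u = value (trans (eval-product x f) (product-cong (at ∘ u)))

  -- The value at x of the identity zpow p (m - n) = p ^ m / p ^ n.
  zpow-⊖ : ∀ x p (p≉0 : p ≉ₚ 0ₚ) m n →
           eval (num (zpow p p≉0 (m ℤ.⊖ n))) x * eval p x ^# n ≈ eval (den (zpow p p≉0 (m ℤ.⊖ n))) x * eval p x ^# m
  zpow-⊖ x p p≉0 zero    zero    = refl
  zpow-⊖ x p p≉0 (suc m) zero    = begin
    eval (p ^ suc m) x * 1#         ≈⟨ *-comm _ _ ⟩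
    1# * eval (p ^ suc m) x         ≈⟨ *-cong (sym (eval-C x 1#)) (eval-^ x p (suc m)) ⟩
    eval 1ₚ x * eval p x ^# suc m   ∎
  zpow-⊖ x p p≉0 zero    (suc n) = begin
    eval 1ₚ x * eval p x ^# suc n   ≈⟨ *-cong (eval-C x 1#) (sym (eval-^ x p (suc n))) ⟩
    1# * eval (p ^ suc n) x         ≈⟨ *-comm _ _ ⟩
    eval (p ^ suc n) x * 1#         ∎
  zpow-⊖ x p p≉0 (suc m) (suc n) rewrite ℤ.[1+m]⊖[1+n]≡m⊖n m n = begin
    eval (num z) x * (eval p x * eval p x ^# n)  ≈⟨ swap (eval (num z) x) (eval p x) (eval p x ^# n) ⟩
    eval p x * (eval (num z) x * eval p x ^# n)  ≈⟨ *-congˡ (zpow-⊖ x p p≉0 m n) ⟩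
    eval p x * (eval (den z) x * eval p x ^# m)  ≈⟨ swap (eval (den z) x) (eval p x) (eval p x ^# m) ⟨
    eval (den z) x * (eval p x * eval p x ^# m)  ∎
    where
    z = zpow p p≉0 (m ℤ.⊖ n)
    swap : ∀ a b c → a * (b * c) ≈ b * (a * c)
    swap = solve 3 (λ a b c → a :* (b :* c) := b :* (a :* c)) refl

  module _ {k₁ k₂ r₁ : ℕ} (G₁ : Graph (Fin (suc k₁))) (G₂ : Graph (Fin (suc k₂)))
           (regular : Regular r₁ G₁)
           (λs : Vector Carrier (suc k₁)) (λ-eigenvalues : Eigenvalues (adjacency G₁) λs)
           (λ-descending : Descending λs)
           (μs : Vector Carrier (suc k₂)) (μ-eigenvalues : Eigenvalues (laplacian G₂) μs)
           (μ-ascending : Ascending μs) where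

    private
      n₁ = suc k₁
      n₂ = suc k₂
      m₁ = size G₁
      N₁ = n₁ ×# 1#
      N₂ = n₂ ×# 1#
      r  = r₁ ×# 1#
      A  = adjacent G₁
      one   = 1 ×# 1#
      two   = 2 ×# 1#
      three = 3 ×# 1#

    adjacency-rowSum : ∀ i → sum (A i) ≈ r
    adjacency-rowSum i = trans (sym (degree-sum G₁ i)) (reflexive (≡.cong (_×# 1#) (regular i)))

    λ₁≈r : λs zero ≈ r
    λ₁≈r = greatestEigenvalue r A λs (adjacent-sym G₁) (λ i j _ → adjacent≥0 G₁ i j) adjacency-rowSum
             (λ x → eval-charpoly-eigenvalues x (adjacency G₁) λs λ-eigenvalues) (λ i → λ-descending zero i ℕ.z≤n)

    μ₁≈0 : μs zero ≈ 0#
    μ₁≈0 = leastEigenvalue 0# (laplacian G₂) μs (laplacian-sym G₂) (laplacian-offDiagonal G₂) (laplacian-rowSum G₂)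
             (λ x → eval-charpoly-eigenvalues x (laplacian G₂) μs μ-eigenvalues) (λ i → μ-ascending zero i ℕ.z≤n)

    -- The factors of the claim: the one that belongs to the eigenvalues r₁ of A
    -- and 0 of the Laplacian of G₂, and those that belong to an eigenvalue ℓ of A
    -- or of the Laplacian of G₂.
    firstFactor : Poly
    firstFactor = X ^ 3 - X ^ 2 *ₚ (nat n₂ +ₚ nat r₁ +ₚ nat 3) +ₚ X *ₚ (nat r₁ +ₚ nat 2 *ₚ nat n₂ +ₚ nat 2)

    adjacencyFactor : Carrier → Poly
    adjacencyFactor ℓ =
      X ^ 3
      - X ^ 2 *ₚ (nat n₁ +ₚ nat n₂ +ₚ nat 3 +ₚ C ℓ)
      +ₚ X *ₚ (nat 2 *ₚ nat n₂ +ₚ nat 3 *ₚ nat n₁ +ₚ nat 2 *ₚ C ℓ +ₚ nat 2 - nat r₁)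
      - nat 2 *ₚ nat n₁ +ₚ nat r₁ - C ℓ

    laplacianFactor : Carrier → Poly
    laplacianFactor ℓ = X - nat 1 - C ℓ

    -- The rational function that the characteristic polynomial is to equal.
    claim : RatFun
    claim = zpow (X - nat 2) (X-nat≉0 2) (+ m₁ ℤ.- + n₁)
        · fromPoly
            ( firstFactor
            *ₚ product≥2 (λ j → laplacianFactor (μs j) ^ n₁)
            *ₚ product≥2 (λ i → adjacencyFactor (λs i)))

    -- The polynomial adjacencyFactor r, written out by coefficients.  Where its
    -- value y d s is nonzero, so is s.
    exceptional : Poly
    exceptional = - (two * N₁) ∷ (two * N₂ + three * N₁ + r + two) ∷ - (N₁ + N₂ + three + r) ∷ 1# ∷ []

    exceptional≉0 : exceptional ≉ₚ 0ₚ
    exceptional≉0 e≈0 = 0≉1 (sym (e≈0 3))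

    module _ (x y⁻¹ d⁻¹ : Carrier)
             (y-inverse : (x -# 1#) * y⁻¹ ≈ 1#) (d-inverse : (x -# (1# + 1#)) * d⁻¹ ≈ 1#)
             (exceptional-x≉0 : eval exceptional x ≉ 0#) where
      private
        module D = CoronaDeterminant K G₁ G₂
        y = x -# 1#
        d = x -# (1# + 1#)
        α = x -# N₁ -# N₂ -# N₂ * y⁻¹ -# r * d⁻¹
        β = 1# + d⁻¹
        s = α -# β * r

      -- The value of the cubic that belongs to an eigenvalue ℓ of A.
      clearDenominators : ∀ ℓ → (y * d) * (α -# β * ℓ) ≈ (y * d) * (x -# N₁ -# N₂ -# ℓ) -# N₂ * d -# (r + ℓ) * y
      clearDenominators ℓ = begin
        (y * d) * (α -# β * ℓ)
          ≈⟨ solve 9 (λ x a b r y d w v ℓ →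
               (y :* d) :* ((x :- a :- b :- b :* w :- r :* v) :- (con (+ 1) :+ v) :* ℓ)
               := (y :* d) :* (x :- a :- b :- ℓ) :- (b :* d) :* (y :* w) :- ((r :+ ℓ) :* y) :* (d :* v))
               refl x N₁ N₂ r y d y⁻¹ d⁻¹ ℓ ⟩
        (y * d) * (x -# N₁ -# N₂ -# ℓ) -# (N₂ * d) * (y * y⁻¹) -# ((r + ℓ) * y) * (d * d⁻¹)
          ≈⟨ +-cong (+-congˡ (-‿cong (trans (*-congˡ y-inverse) (*-identityʳ _))))
                    (-‿cong (trans (*-congˡ d-inverse) (*-identityʳ _))) ⟩
        (y * d) * (x -# N₁ -# N₂ -# ℓ) -# N₂ * d -# (r + ℓ) * y ∎

      eval-exceptional : eval exceptional x ≈ (y * d) * s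
      eval-exceptional = sym (trans (clearDenominators r)
        (solve 4 (λ x a b r → let y = x :- con (+ 1) ; d = x :- (con (+ 1) :+ con (+ 1))
                                  2# = con (+ 1) :+ (con (+ 1) :+ con (+ 0)) ; 3# = con (+ 1) :+ 2# in
             (y :* d) :* (x :- a :- b :- r) :- b :* d :- (r :+ r) :* y
             := :- (2# :* a) :+ x :* ((2# :* b :+ 3# :* a :+ r :+ 2#) :+ x :* (:- (a :+ b :+ 3# :+ r) :+ x :* (con (+ 1) :+ x :* con (+ 0)))))
           refl x N₁ N₂ r))

      eval-firstFactor : eval firstFactor x ≈ (y * d) * (s + N₁)
      eval-firstFactor = begin
        eval firstFactor x
          ≈⟨ at (valueX x ⊡ 3 ⊟ valueX x ⊡ 2 ⊠ (valueN x n₂ ⊞ valueN x r₁ ⊞ valueN x 3)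
                 ⊞ valueX x ⊠ (valueN x r₁ ⊞ valueN x 2 ⊠ valueN x n₂ ⊞ valueN x 2)) ⟩
        x ^# 3 -# x ^# 2 * (N₂ + r + three) + x * (r + two * N₂ + two)
          ≈⟨ solve 4 (λ x a b r → let y = x :- con (+ 1) ; d = x :- (con (+ 1) :+ con (+ 1))
                                      2# = con (+ 1) :+ (con (+ 1) :+ con (+ 0)) ; 3# = con (+ 1) :+ 2# ; x² = x :* (x :* con (+ 1)) in
               x :* x² :- x² :* (b :+ r :+ 3#) :+ x :* (r :+ 2# :* b :+ 2#)
               := ((y :* d) :* (x :- a :- b :- r) :- b :* d :- (r :+ r) :* y) :+ (y :* d) :* a)
             refl x N₁ N₂ r ⟩
        ((y * d) * (x -# N₁ -# N₂ -# r) -# N₂ * d -# (r + r) * y) + (y * d) * N₁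
          ≈⟨ +-congʳ (clearDenominators r) ⟨
        (y * d) * s + (y * d) * N₁
          ≈⟨ distribˡ (y * d) s N₁ ⟨
        (y * d) * (s + N₁) ∎

      eval-adjacencyFactor : ∀ ℓ → eval (adjacencyFactor ℓ) x ≈ (y * d) * (α -# β * ℓ)
      eval-adjacencyFactor ℓ = begin
        eval (adjacencyFactor ℓ) x
          ≈⟨ at (valueX x ⊡ 3
                 ⊟ valueX x ⊡ 2 ⊠ (valueN x n₁ ⊞ valueN x n₂ ⊞ valueN x 3 ⊞ valueC x ℓ)
                 ⊞ valueX x ⊠ (valueN x 2 ⊠ valueN x n₂ ⊞ valueN x 3 ⊠ valueN x n₁ ⊞ valueN x 2 ⊠ valueC x ℓ ⊞ valueN x 2 ⊟ valueN x r₁)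
                 ⊟ valueN x 2 ⊠ valueN x n₁ ⊞ valueN x r₁ ⊟ valueC x ℓ) ⟩
        x ^# 3 -# x ^# 2 * (N₁ + N₂ + three + ℓ) + x * (two * N₂ + three * N₁ + two * ℓ + two -# r) -# two * N₁ + r -# ℓ
          ≈⟨ solve 5 (λ x a b r ℓ → let y = x :- con (+ 1) ; d = x :- (con (+ 1) :+ con (+ 1))
                                        2# = con (+ 1) :+ (con (+ 1) :+ con (+ 0)) ; 3# = con (+ 1) :+ 2# ; x² = x :* (x :* con (+ 1)) in
               x :* x² :- x² :* (a :+ b :+ 3# :+ ℓ) :+ x :* (2# :* b :+ 3# :* a :+ 2# :* ℓ :+ 2# :- r) :- 2# :* a :+ r :- ℓ
               := (y :* d) :* (x :- a :- b :- ℓ) :- b :* d :- (r :+ ℓ) :* y)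
             refl x N₁ N₂ r ℓ ⟩
        (y * d) * (x -# N₁ -# N₂ -# ℓ) -# N₂ * d -# (r + ℓ) * y
          ≈⟨ clearDenominators ℓ ⟨
        (y * d) * (α -# β * ℓ) ∎

      eval-laplacianFactor : ∀ ℓ → eval (laplacianFactor ℓ) x ≈ y -# ℓ
      eval-laplacianFactor ℓ = trans (at (valueX x ⊟ valueN x 1 ⊟ valueC x ℓ)) (+-congʳ (+-congˡ (-‿cong (+-identityʳ 1#))))

      s≉0 : s ≉ 0#
      s≉0 s≈0 = exceptional-x≉0 (trans eval-exceptional (trans (*-congˡ s≈0) (zeroʳ _)))

      y≉0 : y ≉ 0#
      y≉0 y≈0 = 0≉1 (trans (sym (zeroˡ y⁻¹)) (trans (*-congʳ (sym y≈0)) y-inverse))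

      β≉0 : β ≉ 0#
      β≉0 β≈0 = y≉0 (begin
        y               ≈⟨ solve 1 (λ x → x :- con (+ 1) := x :- (con (+ 1) :+ con (+ 1)) :+ con (+ 1)) refl x ⟩
        d + 1#          ≈⟨ +-congˡ d-inverse ⟨
        d + d * d⁻¹     ≈⟨ solve 2 (λ d w → d :+ d :* w := d :* (con (+ 1) :+ w)) refl d d⁻¹ ⟩
        d * β           ≈⟨ *-congˡ β≈0 ⟩
        d * 0#          ≈⟨ zeroʳ d ⟩
        0#              ∎)

      private
        Q₁ = product# (λ i → α -# β * λs (suc i))
        Q₂ = product# (λ j → y -# μs (suc j))
        M  = λ i j → α * δ i j -# β * A i j

      columnSum-M : ∀ j → sum (λ i → M i j) ≈ s
      columnSum-M j = begin
        sum (λ i → α * δ i j -# β * A i j)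
          ≈⟨ D.sum-sub (λ i → α * δ i j) (λ i → β * A i j) ⟩
        sum (λ i → α * δ i j) -# sum (λ i → β * A i j)
          ≈⟨ +-cong (sum-δʳ (λ _ → α) j) (-‿cong (begin
               sum (λ i → β * A i j)  ≈⟨ *-distribˡ-sum β (λ i → A i j) ⟨
               β * sum (λ i → A i j)  ≈⟨ *-congˡ (sum-cong-≋ (λ i → adjacent-sym G₁ i j)) ⟩
               β * sum (A j)          ≈⟨ *-congˡ (adjacency-rowSum j) ⟩
               β * r                  ∎)) ⟩
        s ∎

      det-M : det M ≈ s * Q₁
      det-M = begin
        det M
          ≈⟨ det-homogeneous A λs (λ z → eval-charpoly-eigenvalues z (adjacency G₁) λs λ-eigenvalues) α β β≉0 ⟩
        (α -# β * λs zero) * Q₁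
          ≈⟨ *-congʳ (+-congˡ (-‿cong (*-congˡ λ₁≈r))) ⟩
        s * Q₁ ∎

      det-corona : det (shifted x (laplacian (G₁ ⊙ G₂))) ≈ (((s + N₁) * Q₁) * d ^# m₁) * (y * Q₂) ^# n₁
      det-corona = begin
        det (shifted x (laplacian (G₁ ⊙ G₂)))
          ≈⟨ D.det-copies x y-inverse d-inverse ⟩
        det (flatten (D.B₂ x y-inverse d-inverse)) * det (shifted y (laplacian G₂)) ^# n₁
          ≈⟨ *-cong (D.det-midpoints x y-inverse d-inverse) (^-congˡ n₁ det-E) ⟩
        (det (λ i j → (x -# N₁ -# N₂ -# N₂ * y⁻¹ -# sum (A i) * d⁻¹) * δ i j -# (1# + d⁻¹) * A i j + 1#) * d ^# m₁)
          * (y * Q₂) ^# n₁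
          ≈⟨ *-congʳ (*-congʳ (det-cong entry)) ⟩
        (det (λ i j → M i j + 1#) * d ^# m₁) * (y * Q₂) ^# n₁
          ≈⟨ *-congʳ (*-congʳ (det-+ones s M columnSum-M Q₁ s≉0 det-M)) ⟩
        (((s + N₁) * Q₁) * d ^# m₁) * (y * Q₂) ^# n₁ ∎
        where
        entry : ∀ i j → (x -# N₁ -# N₂ -# N₂ * y⁻¹ -# sum (A i) * d⁻¹) * δ i j -# (1# + d⁻¹) * A i j + 1# ≈ M i j + 1#
        entry i j = +-congʳ (+-congʳ (*-congʳ (+-congˡ (-‿cong (*-congʳ (adjacency-rowSum i))))))

        det-E : det (shifted y (laplacian G₂)) ≈ y * Q₂
        det-E = begin
          det (shifted y (laplacian G₂))
            ≈⟨ eval-charpoly-eigenvalues y (laplacian G₂) μs μ-eigenvalues ⟩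
          (y -# μs zero) * Q₂
            ≈⟨ *-congʳ (trans (+-congˡ (trans (-‿cong μ₁≈0) -0#≈0#)) (+-identityʳ y)) ⟩
          y * Q₂ ∎

      claim-at : eval (charpoly (laplacian (G₁ ⊙ G₂)) *ₚ den claim) x ≈ eval (num claim *ₚ 1ₚ) x
      claim-at = begin
        eval (charpoly (laplacian (G₁ ⊙ G₂)) *ₚ (den z *ₚ 1ₚ)) x
          ≈⟨ at (value {x} {charpoly (laplacian (G₁ ⊙ G₂))} (trans (eval-charpoly x (laplacian (G₁ ⊙ G₂))) det-corona)
                 ⊠ (value {x} {den z} refl ⊠ valueC x 1#)) ⟩
        ((((s + N₁) * Q₁) * d ^# m₁) * (y * Q₂) ^# n₁) * (zd * 1#)
          ≈⟨ *-congʳ (*-congˡ (^-distrib-* y Q₂ n₁)) ⟩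
        ((((s + N₁) * Q₁) * d ^# m₁) * (y ^# n₁ * Q₂ ^# n₁)) * (zd * 1#)
          ≈⟨ solve 6 (λ a q e f g z → (((a :* q) :* e) :* (f :* g)) :* (z :* con (+ 1)) := (z :* e) :* (a :* q :* (f :* g)))
                   refl (s + N₁) Q₁ (d ^# m₁) (y ^# n₁) (Q₂ ^# n₁) zd ⟩
        (zd * d ^# m₁) * ((s + N₁) * Q₁ * (y ^# n₁ * Q₂ ^# n₁))
          ≈⟨ *-congʳ zn-zd ⟨
        (zn * d ^# n₁) * ((s + N₁) * Q₁ * (y ^# n₁ * Q₂ ^# n₁))
          ≈⟨ solve 6 (λ a q e f g z → (z :* e) :* ((a :* q) :* (f :* g)) := ((z :* (a :* g :* q)) :* (f :* e)))
                   refl (s + N₁) Q₁ (d ^# n₁) (y ^# n₁) (Q₂ ^# n₁) zn ⟩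
        (zn * ((s + N₁) * Q₂ ^# n₁ * Q₁)) * (y ^# n₁ * d ^# n₁)
          ≈⟨ *-congˡ (^-distrib-* y d n₁) ⟨
        (zn * ((s + N₁) * Q₂ ^# n₁ * Q₁)) * ((y * d) * (y * d) ^# k₁)
          ≈⟨ solve 6 (λ a q g z p e → (z :* (a :* g :* q)) :* (p :* e) := (z :* (((p :* a) :* g) :* (e :* q))) :* con (+ 1))
                   refl (s + N₁) Q₁ (Q₂ ^# n₁) zn (y * d) ((y * d) ^# k₁) ⟩
        (zn * ((((y * d) * (s + N₁)) * Q₂ ^# n₁) * ((y * d) ^# k₁ * Q₁))) * 1#
          ≈⟨ *-congʳ (*-congˡ (*-cong (*-congˡ (product-^ n₁ (λ j → y -# μs (suc j))))
                                     (product-* (y * d) (λ i → α -# β * λs (suc i))))) ⟨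
        (zn * ((((y * d) * (s + N₁)) * product# (λ j → (y -# μs (suc j)) ^# n₁))
                 * product# (λ i → (y * d) * (α -# β * λs (suc i))))) * 1#
          ≈⟨ at (value {x} {num z} refl
                 ⊠ (value {x} {firstFactor} eval-firstFactor
                    ⊠ valueProduct x {f = λ j → laplacianFactor (μs (suc j)) ^ n₁}
                        (λ j → value {x} {laplacianFactor (μs (suc j))} (eval-laplacianFactor (μs (suc j))) ⊡ n₁)
                    ⊠ valueProduct x {f = λ i → adjacencyFactor (λs (suc i))}
                        (λ i → value {x} {adjacencyFactor (λs (suc i))} (eval-adjacencyFactor (λs (suc i)))))
                 ⊠ valueC x 1#) ⟨
        eval (num claim *ₚ 1ₚ) x ∎
        where
        z  = zpow (X - nat 2) (X-nat≉0 2) (+ m₁ ℤ.- + n₁)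
        zn = eval (num z) x
        zd = eval (den z) x

        eval-X-2 : eval (X - nat 2) x ≈ d
        eval-X-2 = trans (at (valueX x ⊟ valueN x 2)) (+-congˡ (-‿cong (+-congˡ (+-identityʳ 1#))))

        zn-zd : zn * d ^# n₁ ≈ zd * d ^# m₁
        zn-zd rewrite ℤ.m-n≡m⊖n m₁ n₁ = begin
          eval (num (z′)) x * d ^# n₁                 ≈⟨ *-congˡ (^-congˡ n₁ eval-X-2) ⟨
          eval (num (z′)) x * eval (X - nat 2) x ^# n₁ ≈⟨ zpow-⊖ x (X - nat 2) (X-nat≉0 2) m₁ n₁ ⟩
          eval (den (z′)) x * eval (X - nat 2) x ^# m₁ ≈⟨ *-congˡ (^-congˡ m₁ eval-X-2) ⟩
          eval (den (z′)) x * d ^# m₁                 ∎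
          where z′ = zpow (X - nat 2) (X-nat≉0 2) (m₁ ℤ.⊖ n₁)

    charpoly-corona : fromPoly (charpoly (laplacian (G₁ ⊙ G₂))) ≃ claim
    charpoly-corona =
      ≈ₚ-generic bad (charpoly (laplacian (G₁ ⊙ G₂)) *ₚ den claim) (num claim *ₚ 1ₚ) bad≉0 agree
      where
      bad : Poly
      bad = (X - nat 1) *ₚ (X - nat 2) *ₚ exceptional

      bad≉0 : bad ≉ₚ 0ₚ
      bad≉0 = *-≉0 ((X - nat 1) *ₚ (X - nat 2)) exceptional
        (*-≉0 (X - nat 1) (X - nat 2) (X-nat≉0 1) (X-nat≉0 2)) exceptional≉0

      eval-bad : ∀ x → eval bad x ≈ (x -# 1#) * (x -# (1# + 1#)) * eval exceptional x
      eval-bad x = begin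
        eval bad x
          ≈⟨ at ((valueX x ⊟ valueN x 1) ⊠ (valueX x ⊟ valueN x 2) ⊠ value {x} {exceptional} refl) ⟩
        (x -# one) * (x -# two) * eval exceptional x
          ≈⟨ *-congʳ (*-cong (+-congˡ (-‿cong (+-identityʳ 1#))) (+-congˡ (-‿cong (+-congˡ (+-identityʳ 1#))))) ⟩
        (x -# 1#) * (x -# (1# + 1#)) * eval exceptional x ∎

      agree : ∀ x → eval bad x ≉ 0# →
              eval (charpoly (laplacian (G₁ ⊙ G₂)) *ₚ den claim) x ≈ eval (num claim *ₚ 1ₚ) x
      agree x bad-x≉0 = claim-at x (proj₁ y⁻¹) (proj₁ d⁻¹) (proj₂ y⁻¹) (proj₂ d⁻¹) e≉0
        where
        y⁻¹ = inverse (x -# 1#) λ y≈0 → bad-x≉0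
          (trans (eval-bad x) (trans (*-congʳ (trans (*-congʳ y≈0) (zeroˡ _))) (zeroˡ _)))
        d⁻¹ = inverse (x -# (1# + 1#)) λ d≈0 → bad-x≉0
          (trans (eval-bad x) (trans (*-congʳ (trans (*-congˡ d≈0) (zeroʳ _))) (zeroˡ _)))

        e≉0 : eval exceptional x ≉ 0#
        e≉0 e≈0 = bad-x≉0 (trans (eval-bad x) (trans (*-congˡ e≈0) (zeroʳ _)))

theorem3p6 :
  ∀ {c ℓ₁ ℓ₂} (K : OrderedField c ℓ₁ ℓ₂) →
  let open Spectral K in
  (n₁ n₂ r₁ : ℕ) (G₁ : Graph (Fin n₁)) (G₂ : Graph (Fin n₂)) →
  Connected G₁ → Connected G₂ → Regular r₁ G₁ →
  (λs : Vector (OrderedField.Carrier K) n₁) →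
  Eigenvalues (adjacency G₁) λs → Descending λs →
  (μs : Vector (OrderedField.Carrier K) n₂) →
  Eigenvalues (laplacian G₂) μs → Ascending μs →
  let m₁ = size G₁ in
  fromPoly (charpoly (laplacian (G₁ ⊙ G₂)))
    ≃ zpow (X - nat 2) (X-nat≉0 2) (+ m₁ ℤ.- + n₁)
      · fromPoly
          ( (X ^ 3 - X ^ 2 * (nat n₂ + nat r₁ + nat 3) + X * (nat r₁ + nat 2 * nat n₂ + nat 2))
          * product≥2 (λ j → (X - nat 1 - C (μs j)) ^ n₁)
          * product≥2 (λ i →
              X ^ 3
              - X ^ 2 * (nat n₁ + nat n₂ + nat 3 + C (λs i))
              + X * (nat 2 * nat n₂ + nat 3 * nat n₁ + nat 2 * C (λs i) + nat 2 - nat r₁)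
              - nat 2 * nat n₁ + nat r₁ - C (λs i))
          )
-- Connected graphs have at least one vertex.
theorem3p6 K zero    _       _  G₁ G₂ G₁-connected _ = λ _ → contradiction (Connected.inhabitant G₁-connected) λ ()
theorem3p6 K (suc _) zero    _  G₁ G₂ _ G₂-connected = λ _ → contradiction (Connected.inhabitant G₂-connected) λ ()
theorem3p6 K (suc _) (suc _) r₁ G₁ G₂ _ _ regular λs λ-eigenvalues λ-descending μs μ-eigenvalues μ-ascending =
  CoronaPolynomial.charpoly-corona K G₁ G₂ regular λs λ-eigenvalues λ-descending μs μ-eigenvalues μ-ascending
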